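{- Let $G$ be a graph and let $d$ and $k$ be positive integers. Given a tree decomposition $\mathcal{T}=(T,\{X_t\}_{t\in V(T)})$ of $G$ and a layering $(V_1,\ldots,V_m)$ of $G$ such that $\alpha(G[X_t\cap V_i])\le k$ for every bag $X_t$ and layer $V_i$, one can compute in $O(|V(T)|\cdot(|V(G)|+|E(G)|))$ time a tree decomposition $\mathcal{T}'=(T,\{X'_t\}_{t\in V(T)})$ of $G^{1+2d}$ (with the same tree $T$) and a layering $(V'_1,\ldots,V'_{\lceil m/(1+2d)\rceil})$ of $G^{1+2d}$ such that $\alpha(G^{1+2d}[X'_t\cap V'_i])\le(1+4d)k$ for every bag $X'_t$ and layer $V'_i$. In particular, if $G$ has layered tree-independence number $k$, then $G^{1+2d}$ has layered tree-independence number at most $(1+4d)k$.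
   Context: For $p\in\mathbb{N}$, $G^p$ is the graph on $V(G)$ in which distinct $u,v$ are adjacent iff their distance in $G$ is at most $p$. $\alpha$ denotes independence number. A tree decomposition of $G$ is a pair $(T,\{X_t\}_{t\in V(T)})$ with $T$ a tree and bags $X_t\subseteq V(G)$ such that every vertex lies in some bag, every edge has both ends in some bag, and for each vertex the nodes whose bags contain it induce a connected subtree. A layering of $G$ is a partition $(V_1,V_2,\ldots)$ of $V(G)$ into possibly empty layers such that every edge joins vertices in the same or consecutive layers. The layered tree-independence number of $G$ is the minimum over tree decompositions and layerings of $\max_{t,i}\alpha(G[X_t\cap V_i])$. -}

module Defs where

open import Data.Bool using (true; false)
open import Data.Fin using (Fin; zero; suc; toℕ; fromℕ; inject₁; _<?_)
open import Data.Fin.Properties using (all?; any?) renaming (_≟_ to _≟ᶠ_)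
open import Data.Fin.Subset using (Subset; inside; outside; _∈_; _∩_; ∣_∣)
open import Data.Fin.Subset.Properties using (_∈?_)
open import Data.List using (List; []; _∷_; _++_; map; filter; length; lookup; allFin; cartesianProduct)
  renaming (tabulate to tabulateᴸ)
open import Data.List.Extrema.Nat using (max)
open import Data.List.Membership.Propositional using () renaming (_∈_ to _∈ᴸ_)
open import Data.List.Relation.Unary.Unique.Propositional using (Unique)
open import Data.Nat using (ℕ; zero; suc; _+_; _∸_; _/_; _^_; _≤_; _<_; s≤s; ∣_-_∣; NonZero)
open import Data.Nat.Properties using (≤-pred; anyUpTo?; allUpTo?; _≟_)
open import Data.Product using (Σ; ∃; _×_; _,_)
open import Data.Vec using ([]; _∷_) renaming (lookup to lookupⱽ; tabulate to tabulateⱽ)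
open import Function using (_∘_; _⇔_; Injective)
open import Relation.Binary.PropositionalEquality using (_≡_; _≢_; refl; sym)
open import Relation.Nullary using (¬_; Dec; yes; no; does; ¬?)
open import Relation.Nullary.Decidable using (_×-dec_; _→-dec_; map′)

------------------------------------------------------------------------
-- Finite simple graphs

record Graph (n : ℕ) : Set₁ where
  field
    Adj    : Fin n → Fin n → Set
    adj?   : ∀ u v → Dec (Adj u v)
    symm   : ∀ {u v} → Adj u v → Adj v u
    irrefl : ∀ {v} → ¬ Adj v v

open Graph public

edges : ∀ {n} → Graph n → List (Fin n × Fin n)
edges {n} G = filter (λ (u , v) → (u <? v) ×-dec adj? G u v)
                     (cartesianProduct (allFin n) (allFin n))

∣E_∣ : ∀ {n} → Graph n → ℕ
∣E G ∣ = length (edges G)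

neighbourhood : ∀ {n} → Graph n → Fin n → Subset n
neighbourhood G v = tabulateⱽ (λ u → does (adj? G v u))

-- The increasing enumeration of a subset.
element : ∀ {n} (A : Subset n) → Fin ∣ A ∣ → Fin n
element (true  ∷ A) zero    = zero
element (true  ∷ A) (suc i) = suc (element A i)
element (false ∷ A) i       = suc (element A i)

-- The induced subgraph, its vertices renumbered by `element`.
infix 9 _[_]
_[_] : ∀ {n} → Graph n → (A : Subset n) → Graph ∣ A ∣
G [ A ] = record
  { Adj    = λ i j → Adj G (element A i) (element A j)
  ; adj?   = λ i j → adj? G (element A i) (element A j)
  ; symm   = symm G
  ; irrefl = irrefl G
  }

Independent : ∀ {n} → Graph n → Subset n → Set
Independent G S = ∀ u v → u ∈ S → v ∈ S → ¬ Adj G u v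

independent? : ∀ {n} (G : Graph n) S → Dec (Independent G S)
independent? G S =
  all? λ u → all? λ v → (u ∈? S) →-dec ((v ∈? S) →-dec ¬? (adj? G u v))

subsets : ∀ n → List (Subset n)
subsets zero    = [] ∷ []
subsets (suc n) = map (outside ∷_) (subsets n) ++ map (inside ∷_) (subsets n)

α : ∀ {n} → Graph n → ℕ
α {n} G = max 0 (map ∣_∣ (filter (independent? G) (subsets n)))

------------------------------------------------------------------------
-- Distance and graph powers

data Walk {n} (G : Graph n) : ℕ → Fin n → Fin n → Set where
  []  : ∀ {u} → Walk G 0 u u
  _∷_ : ∀ {l u v w} → Adj G u v → Walk G l v w → Walk G (suc l) u w

walk? : ∀ {n} (G : Graph n) l u v → Dec (Walk G l u v)
walk? G zero    u v = map′ (λ { refl → [] }) (λ { [] → refl }) (u ≟ᶠ v)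
walk? G (suc l) u w =
  map′ (λ (_ , a , p) → a ∷ p) (λ { (a ∷ p) → _ , a , p })
       (any? λ v → adj? G u v ×-dec walk? G l v w)

snoc : ∀ {n} {G : Graph n} {l u v w} → Walk G l u v → Adj G v w → Walk G (suc l) u w
snoc []      b = b ∷ []
snoc (a ∷ p) b = a ∷ snoc p b

reverse : ∀ {n} {G : Graph n} {l u v} → Walk G l u v → Walk G l v u
reverse         []      = []
reverse {G = G} (a ∷ p) = snoc (reverse p) (symm G a)

-- Vertices in different components have no distance.
IsDistance : ∀ {n} → Graph n → Fin n → Fin n → ℕ → Set
IsDistance G u v l = Walk G l u v × (∀ {i} → i < l → ¬ Walk G i u v)

DistanceAtMost : ∀ {n} → Graph n → ℕ → Fin n → Fin n → Set
DistanceAtMost G p u v = ∃ λ l → l ≤ p × IsDistance G u v l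

distanceAtMost? : ∀ {n} (G : Graph n) p u v → Dec (DistanceAtMost G p u v)
distanceAtMost? G p u v =
  map′ (λ (l , q , r) → l , ≤-pred q , r) (λ (l , q , r) → l , s≤s q , r)
       (anyUpTo? (λ l → walk? G l u v ×-dec allUpTo? (λ i → ¬? (walk? G i u v)) l) (suc p))

power : ∀ {n} → Graph n → ℕ → Graph n
power G p = record
  { Adj    = λ u v → u ≢ v × DistanceAtMost G p u v
  ; adj?   = λ u v → ¬? (u ≟ᶠ v) ×-dec distanceAtMost? G p u v
  ; symm   = λ (u≢v , l , l≤p , w , least) →
               u≢v ∘ sym , l , l≤p , reverse w , λ i<l → least i<l ∘ reverse
  ; irrefl = λ (v≢v , _) → v≢v refl
  }

------------------------------------------------------------------------
-- Tree decompositions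

Connected : ∀ {n} → Graph n → Set
Connected G = ∀ u v → ∃ λ l → Walk G l u v

-- No cycle c₀ c₁ … c₍ₗ₊₂₎ c₀ on at least three distinct vertices.
Acyclic : ∀ {n} → Graph n → Set
Acyclic {n} G = ∀ {l} (c : Fin (3 + l) → Fin n) → Injective _≡_ _≡_ c →
  (∀ i → Adj G (c (inject₁ i)) (c (suc i))) → ¬ Adj G (c (fromℕ (2 + l))) (c zero)

record IsTree {N} (T : Graph N) : Set where
  field
    nonempty  : NonZero N
    connected : Connected T
    acyclic   : Acyclic T

nodesContaining : ∀ {n N} → (Fin N → Subset n) → Fin n → Subset N
nodesContaining X v = tabulateⱽ (λ t → lookupⱽ (X t) v)

record IsTreeDecomposition {n N} (G : Graph n) (T : Graph N) (X : Fin N → Subset n) : Set where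
  field
    isTree         : IsTree T
    coversVertices : ∀ v → ∃ λ t → v ∈ X t
    coversEdges    : ∀ {u v} → Adj G u v → ∃ λ t → u ∈ X t × v ∈ X t
    connected      : ∀ v → Connected (T [ nodesContaining X v ])

------------------------------------------------------------------------
-- Layerings.  An ordered partition of V(G) into m possibly empty parts is
-- given by the function sending each vertex to the index of its part;
-- indices start at 0.

layer : ∀ {n m} → (Fin n → Fin m) → Fin m → Subset n
layer L i = tabulateⱽ (λ v → does (L v ≟ᶠ i))

IsLayering : ∀ {n m} → Graph n → (Fin n → Fin m) → Set
IsLayering G L = ∀ {u v} → Adj G u v → ∣ toℕ (L u) - toℕ (L v) ∣ ≤ 1

record LayeredTreeDecomposition {n} (G : Graph n) : Set₁ where
  field
    {nodes}             : ℕ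
    {numLayers}         : ℕ
    tree                : Graph nodes
    bag                 : Fin nodes → Subset n
    layering            : Fin n → Fin numLayers
    isTreeDecomposition : IsTreeDecomposition G tree bag
    isLayering          : IsLayering G layering

  width : ℕ
  width = max 0 (tabulateᴸ λ t → max 0 (tabulateᴸ λ i → α (G [ bag t ∩ layer layering i ])))

open LayeredTreeDecomposition public using (width)

IsLayeredTreeIndependenceNumber : ∀ {n} → Graph n → ℕ → Set₁
IsLayeredTreeIndependenceNumber G k =
  (Σ (LayeredTreeDecomposition G) λ D → width D ≡ k) ×
  (∀ (D : LayeredTreeDecomposition G) → k ≤ width D)

-- The minimum is at most k: some member of the family minimised over is at
-- most k, and hence so is any number that is the minimum.
LayeredTreeIndependenceNumberAtMost : ∀ {n} → Graph n → ℕ → Set₁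
LayeredTreeIndependenceNumberAtMost G k =
  (Σ (LayeredTreeDecomposition G) λ D → width D ≤ k) ×
  (∀ j → IsLayeredTreeIndependenceNumber G j → j ≤ k)

⌈_/_⌉ : (m q : ℕ) .{{_ : NonZero q}} → ℕ
⌈ m / q ⌉ = (m + (q ∸ 1)) / q

------------------------------------------------------------------------
-- Word RAM with structured control flow.  A program is a fixed finite
-- syntax tree, so it uses finitely many registers and arrays; every
-- instruction and every test costs one step.

Reg Arr : Set
Reg = ℕ
Arr = ℕ

data Op : Set where
  add monus quot : Op

⟦_⟧ : Op → ℕ → ℕ → ℕ
⟦ add   ⟧ a b       = a + b
⟦ monus ⟧ a b       = a ∸ b
⟦ quot  ⟧ a zero    = 0
⟦ quot  ⟧ a (suc b) = a / suc b

infixr 4 _⨾_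
data Program : Set where
  const : Reg → ℕ → Program
  arith : Reg → Op → Reg → Reg → Program
  load  : Reg → Arr → Reg → Program
  store : Arr → Reg → Reg → Program
  skip  : Program
  _⨾_   : Program → Program → Program
  ifnz  : Reg → Program → Program → Program
  while : Reg → Program → Program

record State : Set where
  constructor state
  field
    reg : Reg → ℕ
    mem : Arr → ℕ → ℕ

open State public

update : ∀ {A : Set} → (ℕ → A) → ℕ → A → ℕ → A
update f x a y with x ≟ y
... | yes _ = a
... | no  _ = f y

setReg : State → Reg → ℕ → State
setReg s x a = state (update (reg s) x a) (mem s)

setMem : State → Arr → ℕ → ℕ → State
setMem s A i a = state (reg s) (update (mem s) A (update (mem s A) i a))

-- Run W P s t s′: from s, program P halts in s′ after t steps.  Every value
-- written must be below W; a program that would write a larger one is stuck.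
data Run (W : ℕ) : Program → State → ℕ → State → Set where
  const : ∀ {s x a} → a < W →
          Run W (const x a) s 1 (setReg s x a)
  arith : ∀ {s x o y z} → ⟦ o ⟧ (reg s y) (reg s z) < W →
          Run W (arith x o y z) s 1 (setReg s x (⟦ o ⟧ (reg s y) (reg s z)))
  load  : ∀ {s x A y} → mem s A (reg s y) < W →
          Run W (load x A y) s 1 (setReg s x (mem s A (reg s y)))
  store : ∀ {s A x y} → reg s y < W →
          Run W (store A x y) s 1 (setMem s A (reg s x) (reg s y))
  skip  : ∀ {s} → Run W skip s 1 s
  _⨾_   : ∀ {P Q s s′ s″ t t′} →
          Run W P s t s′ → Run W Q s′ t′ s″ → Run W (P ⨾ Q) s (t + t′) s″
  ifnz-true  : ∀ {x P Q s t s′} → reg s x ≢ 0 →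
          Run W P s t s′ → Run W (ifnz x P Q) s (1 + t) s′
  ifnz-false : ∀ {x P Q s t s′} → reg s x ≡ 0 →
          Run W Q s t s′ → Run W (ifnz x P Q) s (1 + t) s′
  while-true : ∀ {x P s s′ s″ t t′} → reg s x ≢ 0 →
          Run W P s t s′ → Run W (while x P) s′ t′ s″ →
          Run W (while x P) s (1 + (t + t′)) s″
  while-false : ∀ {x P s} → reg s x ≡ 0 →
          Run W (while x P) s 1 s

------------------------------------------------------------------------
-- Data representation

-- A family of sets as consecutive duplicate-free lists, in arbitrary order:
-- list i occupies positions start[i], …, start[i+1]-1 of the array items.
record StoresFamily (s : State) (start items : Arr) {r n} (F : Fin r → Subset n) : Set where
  field
    list       : Fin r → List (Fin n)
    unique     : ∀ i → Unique (list i)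
    members    : ∀ i v → v ∈ᴸ list i ⇔ v ∈ F i
    start-zero : mem s start 0 ≡ 0
    start-suc  : ∀ i → mem s start (suc (toℕ i)) ≡ mem s start (toℕ i) + length (list i)
    item       : ∀ i j → mem s items (mem s start (toℕ i) + toℕ j) ≡ toℕ (lookup (list i) j)

-- Adjacency lists.
record StoresGraph (s : State) (size : Reg) (start items : Arr) {n} (G : Graph n) : Set where
  field
    vertices : reg s size ≡ n
    lists    : StoresFamily s start items (neighbourhood G)

record StoresLayering (s : State) (count : Reg) (index : Arr) {n m} (L : Fin n → Fin m) : Set where
  field
    numLayers : reg s count ≡ m
    layerOf   : ∀ v → mem s index (toℕ v) ≡ toℕ (L v)

-- Registers: 0 = |V(G)|, 1 = |V(T)|, 2 = m, 3 = d.
-- Registers and arrays not mentioned have arbitrary initial contents.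
record Input (s : State) {n N m} (G : Graph n) (T : Graph N) (X : Fin N → Subset n)
             (L : Fin n → Fin m) (d : ℕ) : Set where
  field
    graph    : StoresGraph s 0 0 1 G
    tree     : StoresGraph s 1 2 3 T
    bags     : StoresFamily s 4 5 X
    layering : StoresLayering s 2 6 L
    radius   : reg s 3 ≡ d

-- Register 4 holds the new number of layers; T stays where it was.
record Output (s : State) {n N m} (T : Graph N) (X : Fin N → Subset n)
              (L : Fin n → Fin m) : Set where
  field
    tree     : StoresGraph s 1 2 3 T
    bags     : StoresFamily s 7 8 X
    layering : StoresLayering s 4 9 L

-- Words have O(log M) bits, where M bounds the size parameters and the
-- numbers occurring in the input.
wordBound : ∀ {n N} → ℕ → Graph n → Graph N → (m d : ℕ) → ℕ
wordBound {n} {N} b G T m d = (2 + n + ∣E G ∣ + N + m + d) ^ b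

{-# OPTIONS --safe #-}
module Submission where

-- The new bags are the closed d-balls around the old ones, and the new layers are blocks of
-- 1+2d consecutive old layers.  Cutting a walk of length at most 1+2d at a middle edge puts both
-- ends of it within distance d of a common bag.  If I is independent in G^(1+2d) and lies in one
-- new bag and one new layer, send each vertex of I to a vertex of the old bag at distance at most
-- d: images of distinct vertices are distinct and non-adjacent in G, since otherwise the vertices
-- would be within distance 1+2d, and the images meet at most 1+4d consecutive old layers.
--
-- The balls are found by one breadth-first search per bag, truncated at depth d.  The list of
-- vertices found so far is at the same time the queue, and each vertex is expanded at most once,
-- so a search costs O(|V(G)| + |E(G)|) whatever the value of d.

open import Defs
open import Data.Bool using (true; false; Bool; _∨_)
open import Data.Bool.Properties using (∨-conicalˡ; ∨-conicalʳ)
open import Data.Empty using (⊥-elim)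
open import Data.Fin using (Fin; zero; suc; toℕ; fromℕ<) renaming (_<_ to _<ᶠ_; _<?_ to _<?ᶠ_)
open import Data.Fin.Properties using (any?; suc-injective; injective⇒≤; toℕ-fromℕ<; toℕ<n; toℕ-injective) renaming (_≟_ to _≟ᶠ_; <-cmp to <-cmpᶠ)
open import Data.Fin.Subset using (Subset; inside; outside; _∈_; _∩_; ∣_∣)
open import Data.Fin.Subset.Properties using (_∈?_; x∈p∩q⁺; x∈p∩q⁻)
open import Data.List using (List; []; _∷_; _++_; map; filter; length; lookup; tabulate; _∷ʳ_; concatMap)
open import Data.List.Extrema.Nat using (max≤v⁺; xs≤max)
open import Data.List.Membership.Propositional using () renaming (_∈_ to _∈ᴸ_)
open import Data.List.Membership.Propositional.Properties using (∈-lookup; ∈-map⁺; ∈-map⁻; ∈-++⁺ˡ; ∈-++⁺ʳ; ∈-tabulate⁺; ∈-tabulate⁻; ∈-filter⁺; ∈-filter⁻; ∈-++⁻; ∈-cartesianProduct⁺; ∈-allFin)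
open import Data.List.Properties using (length-map; length-tabulate; length-++; ++-assoc; map-++; ++-identityʳ; concatMap-++; filter-all)
open import Data.List.Relation.Unary.All as All using (All; []; _∷_)
import Data.List.Relation.Unary.All.Properties as Allₚ
open import Data.List.Relation.Unary.AllPairs using ([]; _∷_; AllPairs)
import Data.List.Relation.Unary.AllPairs.Properties as AllPairsₚ
open import Data.List.Relation.Unary.Any using (here; there; index)
open import Data.List.Relation.Unary.Any.Properties using (lookup-index)
open import Data.List.Relation.Unary.Unique.Propositional using (Unique)
import Data.List.Relation.Unary.Unique.Propositional.Properties as Uniqueₚ
open import Data.Nat using (ℕ; zero; suc; _+_; _*_; _∸_; _/_; _%_; _≤_; _<_; z≤n; s≤s; z<s; ∣_-_∣; NonZero)
open import Data.Nat.DivMod using (m≡m%n+[m/n]*n; m%n<n; m/n*n≤m; /-monoˡ-≤; n/n≡1; +-distrib-/-∣ʳ; m/n≤m)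
open import Data.Nat.Divisibility using (n∣n)
open import Data.Nat.Induction using (<-rec)
open import Data.Nat.Properties hiding (suc-injective)
open import Data.Nat.Tactic.RingSolver using (solve-∀)
open import Data.Product using (Σ; ∃; ∃₂; _×_; _,_; proj₁; proj₂; swap)
open import Data.Sum as Sum using (_⊎_; inj₁; inj₂; [_,_]′)
open import Data.Vec using ([]; _∷_; here; there) renaming (tabulate to tabulateⱽ)
open import Data.Vec.Properties using (lookup∘tabulate; lookup⇒[]=; []=⇒lookup)
open import Function using (_∘_; _⇔_; mk⇔; Equivalence)
open import Relation.Binary.Definitions using (tri<; tri≈; tri>)
open import Relation.Binary.PropositionalEquality using (_≡_; _≢_; refl; sym; trans; cong; cong₂; subst; subst₂; cong-app; module ≡-Reasoning)
open import Relation.Nullary using (¬_; Dec; yes; no; does; contradiction)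
open import Relation.Nullary.Decidable using (_×-dec_; dec-true)

-- Lists without repetitions

-- Two points decide the shape of the proof. Marking a vertex when it is first met is safe only if
-- it is then met at its smallest depth; otherwise the truncation at `d` could cut off vertices of
-- the ball. The search invariant therefore keeps, besides soundness, the order of the marks along
-- the queue. And the queue grows while it is consumed, so the number of iterations is not known
-- when the loop starts: loops are charged to a potential, here the part of a budget linear in
-- |V(G)| + |E(G)| that expanded vertices have not yet spent. Storing the remaining depth instead of
-- the distance lets one number say unseen (0), found but not to be expanded (1), or, lowered by
-- one, the mark to hand on to neighbours.

lookup-injective : ∀ {A : Set} {xs : List A} → Unique xs → ∀ {i j} → lookup xs i ≡ lookup xs j → i ≡ j
lookup-injective (_   ∷ _)  {zero}  {zero}  _  = refl
lookup-injective (x∉  ∷ _)  {zero}  {suc j} eq = ⊥-elim (All.lookup x∉ (∈-lookup j) eq)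
lookup-injective (x∉  ∷ _)  {suc i} {zero}  eq = ⊥-elim (All.lookup x∉ (∈-lookup i) (sym eq))
lookup-injective (_   ∷ xs) {suc i} {suc j} eq = cong suc (lookup-injective xs eq)

Unique-⊆⇒length≤ : ∀ {A : Set} {xs ys : List A} → Unique xs → (∀ {x} → x ∈ᴸ xs → x ∈ᴸ ys) → length xs ≤ length ys
Unique-⊆⇒length≤ {xs = xs} {ys} uniq sub = injective⇒≤ {f = position} position-injective
  where
  position : Fin (length xs) → Fin (length ys)
  position i = index (sub (∈-lookup i))

  lookup-position : ∀ i → lookup xs i ≡ lookup ys (position i)
  lookup-position i = lookup-index (sub (∈-lookup i))

  position-injective : ∀ {i j} → position i ≡ position j → i ≡ j
  position-injective {i} {j} eq = lookup-injective uniq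
    (trans (lookup-position i) (trans (cong (lookup ys) eq) (sym (lookup-position j))))

Unique-length≤n : ∀ {n} {xs : List (Fin n)} → Unique xs → length xs ≤ n
Unique-length≤n {xs = xs} uniq = injective⇒≤ {f = lookup xs} (lookup-injective uniq)

Unique-map⁺ : ∀ {A B : Set} {f : A → B} {xs} →
  (∀ {x y} → x ∈ᴸ xs → y ∈ᴸ xs → f x ≡ f y → x ≡ y) → Unique xs → Unique (map f xs)
Unique-map⁺ inj []         = []
Unique-map⁺ inj (x∉ ∷ uniq) =
  Allₚ.map⁺ (All.tabulate λ y∈ eq → All.lookup x∉ y∈ (inj (here refl) (there y∈) eq))
  ∷ Unique-map⁺ (λ x∈ y∈ → inj (there x∈) (there y∈)) uniq

length-filter-split : ∀ {A : Set} {P Q R : A → Set} (P? : ∀ x → Dec (P x)) (Q? : ∀ x → Dec (Q x)) (R? : ∀ x → Dec (R x)) →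
  (∀ {x} → P x → Q x ⊎ R x) → ∀ xs → length (filter P? xs) ≤ length (filter Q? xs) + length (filter R? xs)
length-filter-split P? Q? R? split [] = z≤n
length-filter-split P? Q? R? split (x ∷ xs) with P? x | Q? x | R? x | length-filter-split P? Q? R? split xs
... | no _  | no _  | no _  | ih = ih
... | no _  | no _  | yes _ | ih = ≤-trans ih (+-monoʳ-≤ _ (n≤1+n _))
... | no _  | yes _ | no _  | ih = m≤n⇒m≤1+n ih
... | no _  | yes _ | yes _ | ih = m≤n⇒m≤1+n (≤-trans ih (+-monoʳ-≤ _ (n≤1+n _)))
... | yes _ | yes _ | no _  | ih = s≤s ih
... | yes _ | yes _ | yes _ | ih = s≤s (≤-trans ih (+-monoʳ-≤ _ (n≤1+n _)))
... | yes _ | no _  | yes _ | ih = ≤-trans (s≤s ih) (≤-reflexive (sym (+-suc _ _)))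
... | yes p | no ¬q | no ¬r | ih with split p
...   | inj₁ q = contradiction q ¬q
...   | inj₂ r = contradiction r ¬r

-- Gives the factor 1+4d: there `f` is the offset of an old layer inside the window met by the
-- representatives, so each class lies in a single old layer.
length≤classes*bound : ∀ {A : Set} (f : A → ℕ) xs k →
  (∀ j → length (filter (λ x → f x ≟ j) xs) ≤ k) →
  ∀ c → length (filter (λ x → f x <? c) xs) ≤ c * k
length≤classes*bound f xs k small zero    = none xs
  where
  none : ∀ xs → length (filter (λ x → f x <? 0) xs) ≤ 0
  none []       = z≤n
  none (x ∷ xs) = none xs
length≤classes*bound f xs k small (suc c) = begin
  length (filter (λ x → f x <? suc c) xs)
    ≤⟨ length-filter-split (λ x → f x <? suc c) (λ x → f x ≟ c) (λ x → f x <? c) split xs ⟩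
  length (filter (λ x → f x ≟ c) xs) + length (filter (λ x → f x <? c) xs)
    ≤⟨ +-mono-≤ (small c) (length≤classes*bound f xs k small c) ⟩
  k + c * k ∎
  where
  open ≤-Reasoning
  split : ∀ {x} → f x < suc c → f x ≡ c ⊎ f x < c
  split fx<1+c with m≤n⇒m<n∨m≡n (≤-pred fx<1+c)
  ... | inj₁ fx<c = inj₂ fx<c
  ... | inj₂ fx≡c = inj₁ fx≡c

-- Subsets

∈-comprehension⁺ : ∀ {n} {P : Fin n → Set} (P? : ∀ v → Dec (P v)) {v} → P v → v ∈ tabulateⱽ (does ∘ P?)
∈-comprehension⁺ P? {v} p =
  lookup⇒[]= v _ (trans (lookup∘tabulate (does ∘ P?) v) (dec-true (P? v) p))

∈-comprehension⁻ : ∀ {n} {P : Fin n → Set} (P? : ∀ v → Dec (P v)) {v} → v ∈ tabulateⱽ (does ∘ P?) → P v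
∈-comprehension⁻ P? {v} v∈ with P? v | trans (sym (lookup∘tabulate (does ∘ P?) v)) ([]=⇒lookup v∈)
... | yes p | _  = p
... | no _  | ()

∈-nodesContaining⁺ : ∀ {n N} (X : Fin N → Subset n) {v t} → v ∈ X t → t ∈ nodesContaining X v
∈-nodesContaining⁺ X {v} {t} v∈ = lookup⇒[]= t _ (trans (lookup∘tabulate _ t) ([]=⇒lookup v∈))

∈-nodesContaining⁻ : ∀ {n N} (X : Fin N → Subset n) {v t} → t ∈ nodesContaining X v → v ∈ X t
∈-nodesContaining⁻ X {v} {t} t∈ = lookup⇒[]= v _ (trans (sym (lookup∘tabulate _ t)) ([]=⇒lookup t∈))

element-∈ : ∀ {n} (A : Subset n) i → element A i ∈ A
element-∈ (true  ∷ A) zero    = here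
element-∈ (true  ∷ A) (suc i) = there (element-∈ A i)
element-∈ (false ∷ A) i       = there (element-∈ A i)

element-injective : ∀ {n} (A : Subset n) {i j} → element A i ≡ element A j → i ≡ j
element-injective (true  ∷ A) {zero}  {zero}  eq = refl
element-injective (true  ∷ A) {suc i} {suc j} eq = cong suc (element-injective A (suc-injective eq))
element-injective (false ∷ A) eq = element-injective A (suc-injective eq)

element-surjective : ∀ {n} (A : Subset n) {v} → v ∈ A → ∃ λ i → element A i ≡ v
element-surjective (true ∷ A) here = zero , refl
element-surjective (true ∷ A) (there v∈) with element-surjective A v∈
... | i , eq = suc i , cong suc eq
element-surjective (false ∷ A) (there v∈) with element-surjective A v∈
... | i , eq = i , cong suc eq

subsets-complete : ∀ {n} (S : Subset n) → S ∈ᴸ subsets n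
subsets-complete []            = here refl
subsets-complete (outside ∷ S) = ∈-++⁺ˡ (∈-map⁺ (outside ∷_) (subsets-complete S))
subsets-complete (inside  ∷ S) = ∈-++⁺ʳ _ (∈-map⁺ (inside ∷_) (subsets-complete S))

-- Independence numbers of induced subgraphs

-- `G [ A ]` renumbers its vertices, so independent sets of different induced subgraphs live in
-- different types. Repetition-free lists of vertices of the whole graph are the common form in
-- which a set in the power graph is turned into a set in `G`.
IndependentList : ∀ {n} → Graph n → List (Fin n) → Set
IndependentList G xs = ∀ {u v} → u ∈ᴸ xs → v ∈ᴸ xs → ¬ Adj G u v

independent⇒∣S∣≤α : ∀ {n} (G : Graph n) S → Independent G S → ∣ S ∣ ≤ α G
independent⇒∣S∣≤α G S ind = All.lookup (xs≤max 0 _)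
  (∈-map⁺ ∣_∣ (∈-filter⁺ (independent? G) (subsets-complete S) ind))

α≤ : ∀ {n} (G : Graph n) k → (∀ S → Independent G S → ∣ S ∣ ≤ k) → α G ≤ k
α≤ {n} G k bound = max≤v⁺ z≤n (Allₚ.map⁺ (All.tabulate λ {S} S∈ →
  bound S (proj₂ (∈-filter⁻ (independent? G) {xs = subsets n} S∈))))

independentList⇒length≤α : ∀ {n} (G : Graph n) (A : Subset n) {xs} → Unique xs → (∀ {v} → v ∈ᴸ xs → v ∈ A) →
  IndependentList G xs → length xs ≤ α (G [ A ])
independentList⇒length≤α {n} G A {xs} uniq xs⊆A ind = begin
  length xs                              ≤⟨ Unique-⊆⇒length≤ uniq contained ⟩
  length (map (element A) (tabulate (element S))) ≡⟨ length-map (element A) (tabulate (element S)) ⟩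
  length (tabulate (element S))          ≡⟨ length-tabulate (element S) ⟩
  ∣ S ∣                                  ≤⟨ independent⇒∣S∣≤α (G [ A ]) S S-independent ⟩
  α (G [ A ])                            ∎
  where
  open ≤-Reasoning
  open import Data.List.Membership.DecPropositional (_≟ᶠ_ {n}) using () renaming (_∈?_ to _∈ᴸ?_)

  S : Subset ∣ A ∣
  S = tabulateⱽ (λ i → does (element A i ∈ᴸ? xs))

  S-independent : Independent (G [ A ]) S
  S-independent i j i∈ j∈ = ind (∈-comprehension⁻ (λ i → element A i ∈ᴸ? xs) i∈)
                                (∈-comprehension⁻ (λ i → element A i ∈ᴸ? xs) j∈)

  contained : ∀ {v} → v ∈ᴸ xs → v ∈ᴸ map (element A) (tabulate (element S))
  contained {v} v∈ with element-surjective A (xs⊆A v∈)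
  ... | i , refl with element-surjective S (∈-comprehension⁺ (λ i → element A i ∈ᴸ? xs) v∈)
  ...   | j , refl = ∈-map⁺ (element A) (∈-tabulate⁺ j)

α[]≤ : ∀ {n} (G : Graph n) (A : Subset n) k →
  (∀ {xs} → Unique xs → (∀ {v} → v ∈ᴸ xs → v ∈ A) → IndependentList G xs → length xs ≤ k) → α (G [ A ]) ≤ k
α[]≤ {n} G A k bound = α≤ (G [ A ]) k λ S ind → begin
  ∣ S ∣         ≡⟨ length-tabulate (vertex S) ⟨
  length (tabulate (vertex S)) ≤⟨ bound
    (Uniqueₚ.tabulate⁺ (element-injective S ∘ element-injective A)) (in-A S) (independent S ind) ⟩
  k             ∎
  where
  open ≤-Reasoning
  vertex : ∀ S → Fin ∣ S ∣ → Fin n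
  vertex S = element A ∘ element S

  in-A : ∀ S {v} → v ∈ᴸ tabulate (vertex S) → v ∈ A
  in-A S v∈ with ∈-tabulate⁻ v∈
  ... | i , refl = element-∈ A (element S i)

  independent : ∀ S → Independent (G [ A ]) S → IndependentList G (tabulate (vertex S))
  independent S ind u∈ v∈ with ∈-tabulate⁻ u∈ | ∈-tabulate⁻ v∈
  ... | i , refl | j , refl = ind (element S i) (element S j) (element-∈ S i) (element-∈ S j)

-- Walks and paths inside a subset

_◅◅_ : ∀ {n} {G : Graph n} {a b u v w} → Walk G a u v → Walk G b v w → Walk G (a + b) u w
[]      ◅◅ q = q
(e ∷ p) ◅◅ q = e ∷ (p ◅◅ q)

splitWalk : ∀ {n} {G : Graph n} a {b u w} → Walk G (a + b) u w → ∃ λ v → Walk G a u v × Walk G b v w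
splitWalk zero    p       = _ , [] , p
splitWalk (suc a) (e ∷ p) with splitWalk a p
... | v , q , r = v , e ∷ q , r

-- `DistanceAtMost` asks for a walk that no walk undercuts. Well-founded recursion on the length
-- replaces the walk by a shorter one as long as `walk?` finds any.
walk⇒distanceAtMost : ∀ {n} (G : Graph n) {l p u v} → Walk G l u v → l ≤ p → DistanceAtMost G p u v
walk⇒distanceAtMost G {l} {p} {u} {v} w l≤p = shortest l l≤p w
  where
  shortest : ∀ l → l ≤ p → Walk G l u v → DistanceAtMost G p u v
  shortest = <-rec _ λ l rec l≤p w → case l rec l≤p w (anyUpTo? (λ i → walk? G i u v) l)
    where
    case : ∀ l → (∀ {i} → i < l → i ≤ p → Walk G i u v → DistanceAtMost G p u v) → l ≤ p → Walk G l u v →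
      Dec (∃ λ i → i < l × Walk G i u v) → DistanceAtMost G p u v
    case l rec l≤p w (yes (i , i<l , w′)) = rec i<l (≤-trans (<⇒≤ i<l) l≤p) w′
    case l rec l≤p w (no  none)           = l , l≤p , w , λ i<l w′ → none (_ , i<l , w′)

-- Walks of `T [ A ]` are tied to the numbering of `A`. Paths over the original nodes can be moved
-- to a larger subset and then concatenated, which is how the connectivity of the new bags is
-- obtained.
data PathIn {N} (T : Graph N) (A : Subset N) : Fin N → Fin N → Set where
  stop : ∀ {t} → t ∈ A → PathIn T A t t
  cross : ∀ {t t′ t″} → t ∈ A → Adj T t t′ → PathIn T A t′ t″ → PathIn T A t t″

module _ {N} {T : Graph N} where

  PathIn-mono : ∀ {A B : Subset N} → (∀ {t} → t ∈ A → t ∈ B) → ∀ {t t′} → PathIn T A t t′ → PathIn T B t t′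
  PathIn-mono A⊆B (stop t∈)     = stop (A⊆B t∈)
  PathIn-mono A⊆B (cross t∈ e p) = cross (A⊆B t∈) e (PathIn-mono A⊆B p)

  PathIn-trans : ∀ {A : Subset N} {t t′ t″} → PathIn T A t t′ → PathIn T A t′ t″ → PathIn T A t t″
  PathIn-trans (stop _)      q = q
  PathIn-trans (cross t∈ e p) q = cross t∈ e (PathIn-trans p q)

  source-∈ : ∀ {A : Subset N} {t t′} → PathIn T A t t′ → t ∈ A
  source-∈ (stop t∈)     = t∈
  source-∈ (cross t∈ _ _) = t∈

  PathIn-sym : ∀ {A : Subset N} {t t′} → PathIn T A t t′ → PathIn T A t′ t
  PathIn-sym (stop t∈)     = stop t∈
  PathIn-sym (cross t∈ e p) = PathIn-trans (PathIn-sym p) (cross (source-∈ p) (symm T e) (stop t∈))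

  walk⇒PathIn : ∀ (A : Subset N) {l i j} → Walk (T [ A ]) l i j → PathIn T A (element A i) (element A j)
  walk⇒PathIn A []      = stop (element-∈ A _)
  walk⇒PathIn A (e ∷ w) = cross (element-∈ A _) e (walk⇒PathIn A w)

  PathIn⇒walk : ∀ (A : Subset N) {t t′ i j} → PathIn T A t t′ → element A i ≡ t → element A j ≡ t′ →
    ∃ λ l → Walk (T [ A ]) l i j
  PathIn⇒walk A (stop _) eq eq′ with element-injective A (trans eq (sym eq′))
  ... | refl = 0 , []
  PathIn⇒walk A (cross _ e p) refl eq′ with element-surjective A (source-∈ p)
  ... | i , refl with PathIn⇒walk A p refl eq′
  ...   | l , w = suc l , e ∷ w

  connected⇒PathIn : ∀ (A : Subset N) → Connected (T [ A ]) → ∀ {t t′} → t ∈ A → t′ ∈ A → PathIn T A t t′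
  connected⇒PathIn A conn t∈ t′∈ with element-surjective A t∈ | element-surjective A t′∈
  ... | i , refl | j , refl = walk⇒PathIn A (proj₂ (conn i j))

  PathIn⇒connected : ∀ (A : Subset N) → (∀ {t t′} → t ∈ A → t′ ∈ A → PathIn T A t t′) → Connected (T [ A ])
  PathIn⇒connected A paths i j = PathIn⇒walk A (paths (element-∈ A i) (element-∈ A j)) refl refl

-- The decomposition of the power graph

module _ {n} (G : Graph n) (d : ℕ) where

  -- The strict bound `l < suc d` is the form decided by `anyUpTo?`.
  Near : Subset n → Fin n → Set
  Near A v = ∃ λ x → x ∈ A × ∃ λ l → l < suc d × Walk G l x v

  near? : ∀ A v → Dec (Near A v)
  near? A v = any? λ x → (x ∈? A) ×-dec anyUpTo? (λ l → walk? G l x v) (suc d)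

  ball : Subset n → Subset n
  ball A = tabulateⱽ (does ∘ near? A)

  ∈-ball⁺ : ∀ A {v} → Near A v → v ∈ ball A
  ∈-ball⁺ A = ∈-comprehension⁺ (near? A)

  ∈-ball⁻ : ∀ A {v} → v ∈ ball A → Near A v
  ∈-ball⁻ A = ∈-comprehension⁻ (near? A)

  walk⇒power-adj : ∀ {l u v} → u ≢ v → Walk G l u v → l ≤ 1 + 2 * d → Adj (power G (1 + 2 * d)) u v
  walk⇒power-adj u≢v w l≤ = u≢v , walk⇒distanceAtMost G w l≤

  ballDecomposition : ∀ {N} {T : Graph N} {X : Fin N → Subset n} → IsTreeDecomposition G T X →
    IsTreeDecomposition (power G (1 + 2 * d)) T (ball ∘ X)
  ballDecomposition {N} {T} {X} td = record
    { isTree         = isTree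
    ; coversVertices = λ v → let t , v∈ = coversVertices v in t , centre t v∈
    ; coversEdges    = λ { (_ , l , l≤ , w , _) → covers w l≤ }
    ; connected      = λ v → PathIn⇒connected (nodesContaining (ball ∘ X) v) λ t∈ t′∈ →
        let c , v∈c = coversVertices v in
        PathIn-trans (toCentre v v∈c (∈-nodesContaining⁻ (ball ∘ X) t∈))
                     (PathIn-sym (toCentre v v∈c (∈-nodesContaining⁻ (ball ∘ X) t′∈)))
    }
    where
    open IsTreeDecomposition td

    centre : ∀ t {v} → v ∈ X t → v ∈ ball (X t)
    centre t v∈ = ∈-ball⁺ (X t) (_ , v∈ , 0 , z<s , [])

    -- Cut a walk of length at most 1+2d into pieces of length at most d around a middle edge.
    covers : ∀ {l u v} → Walk G l u v → l ≤ 1 + 2 * d → ∃ λ t → u ∈ ball (X t) × v ∈ ball (X t)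
    covers {l} {u} {v} w l≤ with l ≤? d
    -- There is no edge in position `d + 1` to cut at, but then any bag with `v` has `u` in its
    -- ball.
    ... | yes l≤d = let t , v∈ = coversVertices v in
                    t , ∈-ball⁺ (X t) (v , v∈ , l , s≤s l≤d , reverse w) , centre t v∈
    ... | no  l≰d with m≤n⇒∃[o]m+o≡n (≰⇒> l≰d)
    ...   | r , refl with splitWalk d (subst (λ k → Walk G k u v) (sym (+-suc d r)) w)
    ...     | x , p , (e ∷ q) with coversEdges e
    ...       | t , x∈ , y∈ = t , ∈-ball⁺ (X t) (_ , x∈ , d , ≤-refl , reverse p)
                                , ∈-ball⁺ (X t) (_ , y∈ , r , s≤s r≤d , q)
      where
      r≤d : r ≤ d
      r≤d = +-cancelˡ-≤ d r d (≤-trans (≤-pred l≤) (≤-reflexive (cong (d +_) (+-identityʳ d))))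

    -- Every vertex `y` on the walk from `x` to `v` is within distance `d` of `v`, so all nodes
    -- whose old bags contain `y` have `v` in their balls. The subtrees of consecutive vertices
    -- share a node by `coversEdges`, and the chain of subtrees leads from `t` to a node whose old
    -- bag contains `v` itself.
    toCentre : ∀ v {c} → v ∈ X c → ∀ {t} → v ∈ ball (X t) → PathIn T (nodesContaining (ball ∘ X) v) t c
    toCentre v {c} v∈c {t} v∈ with ∈-ball⁻ (X t) v∈
    ... | x , x∈ , l , l<1+d , w = along w l<1+d x∈
      where
      along : ∀ {l x t} → Walk G l x v → l < suc d → x ∈ X t → PathIn T (nodesContaining (ball ∘ X) v) t c
      inside-tree : ∀ {l x t t′} → Walk G l x v → l < suc d → x ∈ X t → x ∈ X t′ →
        PathIn T (nodesContaining (ball ∘ X) v) t t′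
      inside-tree {l} {x} w l< x∈t x∈t′ = PathIn-mono
        (λ {t} t∈ → ∈-nodesContaining⁺ (ball ∘ X) (∈-ball⁺ (X t) (x , ∈-nodesContaining⁻ X t∈ , l , l< , w)))
        (connected⇒PathIn (nodesContaining X x) (connected x) (∈-nodesContaining⁺ X x∈t) (∈-nodesContaining⁺ X x∈t′))
      along []      l< x∈ = inside-tree [] l< x∈ v∈c
      along (e ∷ w) l< x∈ with coversEdges e
      ... | t′ , x∈t′ , y∈t′ = PathIn-trans (inside-tree (e ∷ w) l< x∈ x∈t′)
                                            (along w (<-trans (n<1+n _) l<) y∈t′)

-- Layers along walks, blocks of layers, and the bound on the independence numbers

module _ {n m} (G : Graph n) (L : Fin n → Fin m) (lay : IsLayering G L) where

  layer-step : ∀ {u v} → Adj G u v → toℕ (L u) ≤ 1 + toℕ (L v)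
  layer-step {u} {v} e = ≤-trans (m≤n+∣m-n∣ (toℕ (L u)) (toℕ (L v)))
    (≤-trans (+-monoʳ-≤ _ (lay e)) (≤-reflexive (+-comm _ 1)))

  layer-walk : ∀ {l u v} → Walk G l u v → toℕ (L u) ≤ l + toℕ (L v)
  layer-walk []      = ≤-refl
  layer-walk (e ∷ w) = ≤-trans (layer-step e) (s≤s (layer-walk w))

-- As `suc m + q` equals `m + suc q`, the ceiling is exactly one more than `m / suc q`.
coarseLayer< : ∀ m q {a} → a < m → a / suc q < ⌈ m / suc q ⌉
coarseLayer< (suc m) q {a} (s≤s a≤m) = begin-strict
  a / suc q             ≤⟨ /-monoˡ-≤ (suc q) a≤m ⟩
  m / suc q             <⟨ n<1+n _ ⟩
  suc (m / suc q)       ≡⟨ +-comm 1 _ ⟩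
  m / suc q + 1         ≡⟨ cong (m / suc q +_) (n/n≡1 (suc q)) ⟨
  m / suc q + suc q / suc q ≡⟨ +-distrib-/-∣ʳ m (n∣n {suc q}) ⟨
  (m + suc q) / suc q   ≡⟨ cong (_/ suc q) (+-suc m q) ⟩
  (suc m + q) / suc q   ∎
  where open ≤-Reasoning

-- The parameter is one less than the block width, so that the divisor is visibly nonzero; with
-- `2 * d` the width is `1 + 2 * d` by definition.
coarsen : ∀ {n m} → (Fin n → Fin m) → ∀ q → Fin n → Fin ⌈ m / suc q ⌉
coarsen {m = m} L q v = fromℕ< (coarseLayer< m q (toℕ<n (L v)))

toℕ-coarsen : ∀ {n m} (L : Fin n → Fin m) q v → toℕ (coarsen L q v) ≡ toℕ (L v) / suc q
toℕ-coarsen {m = m} L q v = toℕ-fromℕ< (coarseLayer< m q (toℕ<n (L v)))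

∣m-n∣≤o⁺ : ∀ {m n o} → m ≤ o + n → n ≤ o + m → ∣ m - n ∣ ≤ o
∣m-n∣≤o⁺ {m} {n} {o} m≤ n≤ with ≤-total m n
... | inj₁ m≤n = ≤-trans (≤-reflexive (m≤n⇒∣m-n∣≡n∸m m≤n)) (m≤n+o⇒m∸n≤o _ m (≤-trans n≤ (≤-reflexive (+-comm o m))))
... | inj₂ n≤m = ≤-trans (≤-reflexive (m≤n⇒∣n-m∣≡n∸m n≤m)) (m≤n+o⇒m∸n≤o _ n (≤-trans m≤ (≤-reflexive (+-comm o n))))

module _ {n m} (G : Graph n) (L : Fin n → Fin m) (lay : IsLayering G L) (d : ℕ) where

  -- A walk of length at most `q` changes the old layer by at most `q`, and adding the divisor to
  -- the numerator raises a quotient by one. Reversing the walk gives the other inequality.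
  coarsen-layering : IsLayering (power G (1 + 2 * d)) (coarsen L (2 * d))
  coarsen-layering {u} {v} (_ , l , l≤ , w , _)
    rewrite toℕ-coarsen L (2 * d) u | toℕ-coarsen L (2 * d) v = ∣m-n∣≤o⁺ (quot≤ w) (quot≤ (reverse w))
    where
    q = 1 + 2 * d
    open ≤-Reasoning
    quot≤ : ∀ {a b} → Walk G l a b → toℕ (L a) / q ≤ 1 + toℕ (L b) / q
    quot≤ {a} {b} w = begin
      toℕ (L a) / q             ≤⟨ /-monoˡ-≤ q (layer-walk G L lay w) ⟩
      (l + toℕ (L b)) / q       ≤⟨ /-monoˡ-≤ q (+-monoˡ-≤ (toℕ (L b)) l≤) ⟩
      (q + toℕ (L b)) / q       ≡⟨ cong (_/ q) (+-comm q (toℕ (L b))) ⟩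
      (toℕ (L b) + q) / q       ≡⟨ +-distrib-/-∣ʳ (toℕ (L b)) (n∣n {q}) ⟩
      toℕ (L b) / q + q / q     ≡⟨ cong (toℕ (L b) / q +_) (n/n≡1 q) ⟩
      toℕ (L b) / q + 1         ≡⟨ +-comm _ 1 ⟩
      1 + toℕ (L b) / q         ∎

  module _ (A : Subset n) (k : ℕ) (small : ∀ i → α (G [ A ∩ layer L i ]) ≤ k) where

    private
      q : ℕ
      q = 1 + 2 * d

      -- Outside the ball the value `v` is a dummy: only members of the ball are sent to their
      -- representatives. The decision is an argument so that `rep-near` can case on it.
      representative : ∀ v → Dec (Near G d A v) → Fin n
      representative v (yes (x , _)) = x
      representative v (no _)        = v

      rep : Fin n → Fin n
      rep v = representative v (near? G d A v)

      rep-near : ∀ {v} → v ∈ ball G d A → rep v ∈ A × ∃ λ l → l ≤ d × Walk G l (rep v) v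
      rep-near {v} v∈ with near? G d A v
      ... | yes (x , x∈ , l , s≤s l≤d , w) = x∈ , l , l≤d , w
      ... | no  far = contradiction (∈-ball⁻ G d A v∈) far

    α-ball≤ : ∀ i → α (power G q [ ball G d A ∩ layer (coarsen L (2 * d)) i ]) ≤ (1 + 4 * d) * k
    α-ball≤ i = α[]≤ (power G q) _ _ bound
      where
      bound : ∀ {xs} → Unique xs → (∀ {v} → v ∈ᴸ xs → v ∈ ball G d A ∩ layer (coarsen L (2 * d)) i) →
        IndependentList (power G q) xs → length xs ≤ (1 + 4 * d) * k
      bound {xs} uniq xs⊆ ind = begin
        length xs              ≡⟨ length-map rep xs ⟨
        length ys              ≡⟨ cong length (filter-all (λ y → offset y <? 1 + 4 * d) (All.tabulate offset<)) ⟨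
        length (filter (λ y → offset y <? 1 + 4 * d) ys)
                               ≤⟨ length≤classes*bound offset ys k class≤ (1 + 4 * d) ⟩
        (1 + 4 * d) * k        ∎
        where
        open ≤-Reasoning
        ys : List (Fin n)
        ys = map rep xs

        lo : ℕ
        lo = toℕ i * q

        -- A representative may lie up to `d` layers below `lo`, the first layer of the block.
        -- Adding `d` beforehand makes the truncated subtraction exact on `ys`, so equal offsets
        -- mean equal layers.
        offset : Fin n → ℕ
        offset y = d + toℕ (L y) ∸ lo

        ball-∈ : ∀ {v} → v ∈ᴸ xs → v ∈ ball G d A
        ball-∈ v∈ = proj₁ (x∈p∩q⁻ _ _ (xs⊆ v∈))

        -- One argument for two uses: `r` = 0 makes `rep` injective on `xs`, and `r` = 1 makes `ys`
        -- independent in `G`. In both cases distinct `u` and `v` would be joined through their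
        -- representatives by a walk of length at most d + 1 + d, hence adjacent in the power.
        connecting : ∀ {u v} (u∈ : u ∈ᴸ xs) (v∈ : v ∈ᴸ xs) {r} → Walk G r (rep u) (rep v) → r ≤ 1 → u ≡ v
        connecting {u} {v} u∈ v∈ {r} w r≤1 with u ≟ᶠ v | rep-near (ball-∈ u∈) | rep-near (ball-∈ v∈)
        ... | yes u≡v | _ | _ = u≡v
        ... | no  u≢v | _ , a , a≤d , p | _ , b , b≤d , p′ = ⊥-elim (ind u∈ v∈
          (walk⇒power-adj G d u≢v (reverse p ◅◅ (w ◅◅ p′)) (begin
            a + (r + b)   ≤⟨ +-mono-≤ a≤d (+-mono-≤ r≤1 b≤d) ⟩
            d + (1 + d)   ≡⟨ +-suc d d ⟩
            1 + (d + d)   ≡⟨ cong (λ z → 1 + (d + z)) (+-identityʳ d) ⟨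
            1 + 2 * d     ∎)))

        ys-unique : Unique ys
        ys-unique = Unique-map⁺ (λ u∈ v∈ eq → connecting u∈ v∈ (subst (Walk G 0 _) eq []) z≤n) uniq

        ys-independent : IndependentList G ys
        ys-independent y∈ z∈ e with ∈-map⁻ rep y∈ | ∈-map⁻ rep z∈
        ... | u , u∈ , refl | v , v∈ , refl with connecting u∈ v∈ (e ∷ []) ≤-refl
        ...   | refl = irrefl G e

        layer-of : ∀ {v} → v ∈ᴸ xs → toℕ (L v) / q ≡ toℕ i
        layer-of {v} v∈ = trans (sym (toℕ-coarsen L (2 * d) v))
          (cong toℕ (∈-comprehension⁻ (λ v → coarsen L (2 * d) v ≟ᶠ i) (proj₂ (x∈p∩q⁻ _ _ (xs⊆ v∈)))))

        -- The 1+4d layers are the 1+2d of the block and `d` more on either side.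
        window : ∀ {y} → y ∈ᴸ ys → lo ≤ d + toℕ (L y) × d + toℕ (L y) < lo + (1 + 4 * d)
        window y∈ with ∈-map⁻ rep y∈
        ... | v , v∈ , refl with rep-near (ball-∈ v∈)
        ...   | _ , l , l≤d , w = lower , upper
          where
          lower : lo ≤ d + toℕ (L (rep v))
          lower = begin
            toℕ i * q               ≡⟨ cong (_* q) (layer-of v∈) ⟨
            toℕ (L v) / q * q       ≤⟨ m/n*n≤m (toℕ (L v)) q ⟩
            toℕ (L v)               ≤⟨ layer-walk G L lay (reverse w) ⟩
            l + toℕ (L (rep v))     ≤⟨ +-monoˡ-≤ _ l≤d ⟩
            d + toℕ (L (rep v))     ∎

          upper : d + toℕ (L (rep v)) < lo + (1 + 4 * d)
          upper = begin-strict
            d + toℕ (L (rep v))     ≤⟨ +-monoʳ-≤ d (layer-walk G L lay w) ⟩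
            d + (l + toℕ (L v))     ≤⟨ +-monoʳ-≤ d (+-monoˡ-≤ _ l≤d) ⟩
            d + (d + toℕ (L v))     ≡⟨ cong (λ z → d + (d + z)) (m≡m%n+[m/n]*n (toℕ (L v)) q) ⟩
            d + (d + (toℕ (L v) % q + toℕ (L v) / q * q))
              ≡⟨ cong (λ z → d + (d + (toℕ (L v) % q + z * q))) (layer-of v∈) ⟩
            d + (d + (toℕ (L v) % q + lo))
              <⟨ +-monoʳ-< d (+-monoʳ-< d (+-monoˡ-< lo (m%n<n (toℕ (L v)) q))) ⟩
            d + (d + (1 + 2 * d + lo))  ≡⟨ rearrange d lo ⟩
            lo + (1 + 4 * d)        ∎
            where
            rearrange : ∀ d lo → d + (d + (1 + 2 * d + lo)) ≡ lo + (1 + 4 * d)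
            rearrange = solve-∀

        offset< : ∀ {y} → y ∈ᴸ ys → offset y < 1 + 4 * d
        offset< y∈ = m<n+o⇒m∸n<o _ lo (proj₂ (window y∈))

        same-layer : ∀ {y z} → y ∈ᴸ ys → z ∈ᴸ ys → offset y ≡ offset z → L y ≡ L z
        same-layer y∈ z∈ eq = toℕ-injective (+-cancelˡ-≡ d _ _
          (∸-cancelʳ-≡ (proj₁ (window y∈)) (proj₁ (window z∈)) eq))

        A-∈ : ∀ {y} → y ∈ᴸ ys → y ∈ A
        A-∈ y∈ with ∈-map⁻ rep y∈
        ... | v , v∈ , refl = proj₁ (rep-near (ball-∈ v∈))

        class≤ : ∀ j → length (filter (λ y → offset y ≟ j) ys) ≤ k
        class≤ j = nonempty⇒ (filter (λ y → offset y ≟ j) ys) refl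
          where
          class : List (Fin n)
          class = filter (λ y → offset y ≟ j) ys

          class⁻ : ∀ {y} → y ∈ᴸ class → y ∈ᴸ ys × offset y ≡ j
          class⁻ = ∈-filter⁻ (λ y → offset y ≟ j)

          -- The old layer to which `small` applies is named through a member of the class; an
          -- offset `j` need not come from any layer, so the empty class is treated apart.
          nonempty⇒ : ∀ zs → class ≡ zs → length zs ≤ k
          nonempty⇒ []       eq = z≤n
          nonempty⇒ (y ∷ zs) eq = subst (λ xs → length xs ≤ k) eq (≤-trans
            (independentList⇒length≤α G (A ∩ layer L (L y))
              (Uniqueₚ.filter⁺ (λ y → offset y ≟ j) ys-unique)
              (λ z∈ → x∈p∩q⁺ (A-∈ (proj₁ (class⁻ z∈)) ,
                ∈-comprehension⁺ (λ v → L v ≟ᶠ L y)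
                  (same-layer (proj₁ (class⁻ z∈)) (proj₁ y∈) (trans (proj₂ (class⁻ z∈)) (sym (proj₂ y∈))))))
              (λ u∈ v∈ → ys-independent (proj₁ (class⁻ u∈)) (proj₁ (class⁻ v∈))))
            (small (L y)))
            where
            y∈ : y ∈ᴸ ys × offset y ≡ j
            y∈ = class⁻ (subst (y ∈ᴸ_) (sym eq) (here refl))

-- From the construction to the layered tree-independence number

width⁺ : ∀ {n} {G : Graph n} (D : LayeredTreeDecomposition G) k → let open LayeredTreeDecomposition D hiding (width) in
  (∀ t i → α (G [ bag t ∩ layer layering i ]) ≤ k) → width D ≤ k
width⁺ D k small = max≤v⁺ z≤n (Allₚ.tabulate⁺ λ t → max≤v⁺ z≤n (Allₚ.tabulate⁺ (small t)))

width⁻ : ∀ {n} {G : Graph n} (D : LayeredTreeDecomposition G) → let open LayeredTreeDecomposition D hiding (width) in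
  ∀ t i → α (G [ bag t ∩ layer layering i ]) ≤ width D
width⁻ D t i = ≤-trans (All.lookup (xs≤max 0 _) (∈-tabulate⁺ i)) (All.lookup (xs≤max 0 _) (∈-tabulate⁺ t))

power-layeredTreeIndependenceNumber : ∀ {n} (G : Graph n) d k → IsLayeredTreeIndependenceNumber G k →
  LayeredTreeIndependenceNumberAtMost (power G (1 + 2 * d)) ((1 + 4 * d) * k)
power-layeredTreeIndependenceNumber G d k ((D , width≡k) , _) =
  (D′ , D′≤) , λ j minimum → ≤-trans (proj₂ minimum D′) D′≤
  where
  open LayeredTreeDecomposition D hiding (width)
  D′ : LayeredTreeDecomposition (power G (1 + 2 * d))
  D′ = record
    { tree                = tree
    ; bag                 = ball G d ∘ bag
    ; layering            = coarsen layering (2 * d)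
    ; isTreeDecomposition = ballDecomposition G d isTreeDecomposition
    ; isLayering          = coarsen-layering G layering isLayering d
    }
  D′≤ : width D′ ≤ (1 + 4 * d) * k
  D′≤ = width⁺ D′ ((1 + 4 * d) * k) λ t →
    α-ball≤ G layering isLayering d (bag t) k λ i → ≤-trans (width⁻ D t i) (≤-reflexive width≡k)

-- Reading after an update

update-same : ∀ {A : Set} (f : ℕ → A) x a → update f x a x ≡ a
update-same f x a with x ≟ x
... | yes _  = refl
... | no x≢x = contradiction refl x≢x

update-other : ∀ {A : Set} (f : ℕ → A) {x y} a → x ≢ y → update f x a y ≡ f y
update-other f {x} {y} a x≢y with x ≟ y
... | yes x≡y = contradiction x≡y x≢y
... | no  _   = refl

-- Frames

-- Read off the syntax, counting both branches and loops that may never run. For a concrete program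
-- and register it computes, so such frame conditions are proved by `refl`.
writesReg : Program → Reg → Bool
writesReg (const x _)     r = does (x ≟ r)
writesReg (arith x _ _ _) r = does (x ≟ r)
writesReg (load x _ _)    r = does (x ≟ r)
writesReg (store _ _ _)   r = false
writesReg skip            r = false
writesReg (P ⨾ Q)         r = writesReg P r ∨ writesReg Q r
writesReg (ifnz _ P Q)    r = writesReg P r ∨ writesReg Q r
writesReg (while _ P)     r = writesReg P r

writesArr : Program → Arr → Bool
writesArr (const _ _)     A = false
writesArr (arith _ _ _ _) A = false
writesArr (load _ _ _)    A = false
writesArr (store B _ _)   A = does (B ≟ A)
writesArr skip            A = false
writesArr (P ⨾ Q)         A = writesArr P A ∨ writesArr Q A
writesArr (ifnz _ P Q)    A = writesArr P A ∨ writesArr Q A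
writesArr (while _ P)     A = writesArr P A

-- Unwritten arrays agree as functions, not only at each address, so statements about whole tables
-- can be transported by `subst`. This holds without extensionality because `setMem` changes `mem`
-- at one array name only.
record Agree (P : Program) (s s′ : State) : Set where
  field
    regs : ∀ r → writesReg P r ≡ false → reg s′ r ≡ reg s r
    arrs : ∀ A → writesArr P A ≡ false → mem s′ A ≡ mem s A

open Agree public

does-false⇒≢ : ∀ {x y} → does (x ≟ y) ≡ false → x ≢ y
does-false⇒≢ {x} {y} eq x≡y with trans (sym eq) (dec-true (x ≟ y) x≡y)
... | ()

update-unwritten : ∀ {A : Set} (f : ℕ → A) x a y → does (x ≟ y) ≡ false → update f x a y ≡ f y
update-unwritten f x a y eq = update-other f {x} {y} a (does-false⇒≢ {x} {y} eq)

agree-refl : ∀ {P s} → Agree P s s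
agree-refl = record { regs = λ _ _ → refl ; arrs = λ _ _ → refl }

agree-trans : ∀ {P s s′ s″} → Agree P s s′ → Agree P s′ s″ → Agree P s s″
agree-trans a b = record
  { regs = λ r eq → trans (regs b r eq) (regs a r eq)
  ; arrs = λ A eq → trans (arrs b A eq) (arrs a A eq)
  }

agree-seq : ∀ {P Q s s′ s″} → Agree P s s′ → Agree Q s′ s″ → Agree (P ⨾ Q) s s″
agree-seq {P} a b = record
  { regs = λ r eq → trans (regs b r (∨-conicalʳ (writesReg P r) _ eq)) (regs a r (∨-conicalˡ (writesReg P r) _ eq))
  ; arrs = λ A eq → trans (arrs b A (∨-conicalʳ (writesArr P A) _ eq)) (arrs a A (∨-conicalˡ (writesArr P A) _ eq))
  }

run⇒agree : ∀ {W P s t s′} → Run W P s t s′ → Agree P s s′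
run⇒agree {s = s} (const {x = x} _) = record
  { regs = λ r → update-unwritten (reg s) x _ r ; arrs = λ _ _ → refl }
run⇒agree {s = s} (arith {x = x} _) = record
  { regs = λ r → update-unwritten (reg s) x _ r ; arrs = λ _ _ → refl }
run⇒agree {s = s} (load {x = x} _) = record
  { regs = λ r → update-unwritten (reg s) x _ r ; arrs = λ _ _ → refl }
run⇒agree {s = s} (store {A = A} _) = record
  { regs = λ _ _ → refl ; arrs = λ B → update-unwritten (mem s) A _ B }
run⇒agree skip    = agree-refl
run⇒agree (p ⨾ q) = agree-seq (run⇒agree p) (run⇒agree q)
run⇒agree (ifnz-true {P = P} _ p) = record
  { regs = λ r eq → regs (run⇒agree p) r (∨-conicalˡ (writesReg P r) _ eq)
  ; arrs = λ A eq → arrs (run⇒agree p) A (∨-conicalˡ (writesArr P A) _ eq) }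
run⇒agree (ifnz-false {P = P} _ q) = record
  { regs = λ r eq → regs (run⇒agree q) r (∨-conicalʳ (writesReg P r) _ eq)
  ; arrs = λ A eq → arrs (run⇒agree q) A (∨-conicalʳ (writesArr P A) _ eq) }
run⇒agree (while-true {x} {P} _ p q) = record
  { regs = λ r eq → trans (regs (run⇒agree q) r eq) (regs (run⇒agree p) r eq)
  ; arrs = λ A eq → trans (arrs (run⇒agree q) A eq) (arrs (run⇒agree p) A eq) }
run⇒agree (while-false _) = agree-refl

-- Total correctness with a time bound

record Reach (W : ℕ) (P : Program) (s : State) (t : ℕ) (Q : State → Set) : Set where
  constructor reach
  field
    {final} : State
    {time}  : ℕ
    run     : Run W P s time final
    time≤   : time ≤ t
    post    : Q final

module _ {W : ℕ} where

  weaken : ∀ {P s t t′ Q Q′} → t ≤ t′ → (∀ {s′} → Agree P s s′ → Q s′ → Q′ s′) → Reach W P s t Q → Reach W P s t′ Q′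
  weaken t≤t′ imp (reach run time≤ post) = reach run (≤-trans time≤ t≤t′) (imp (run⇒agree run) post)

  infixr 4 _▷_
  -- The continuation receives the frame of `P` along with its postcondition, so a postcondition
  -- need only speak of what `P` changes.
  _▷_ : ∀ {P P′ s t t′ Q R} → Reach W P s t Q → (∀ s′ → Agree P s s′ → Q s′ → Reach W P′ s′ t′ R) →
    Reach W (P ⨾ P′) s (t + t′) R
  reach run time≤ post ▷ next with next _ (run⇒agree run) post
  ... | reach run′ time≤′ post′ = reach (run ⨾ run′) (+-mono-≤ time≤ time≤′) post′

  skip-rule : ∀ {s} {Q : State → Set} → Q s → Reach W skip s 1 Q
  skip-rule post = reach skip ≤-refl post

  const-seq : ∀ {s x a P t Q} → a < W → Reach W P (setReg s x a) t Q → Reach W (const x a ⨾ P) s (suc t) Q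
  const-seq a<W (reach run time≤ post) = reach (const a<W ⨾ run) (s≤s time≤) post

  arith-rule : ∀ {s x o y z a} {Q : State → Set} → ⟦ o ⟧ (reg s y) (reg s z) ≡ a → a < W →
    Q (setReg s x a) → Reach W (arith x o y z) s 1 Q
  arith-rule refl a<W post = reach (arith a<W) ≤-refl post

  arith-seq : ∀ {s x o y z a P t Q} → ⟦ o ⟧ (reg s y) (reg s z) ≡ a → a < W →
    Reach W P (setReg s x a) t Q → Reach W (arith x o y z ⨾ P) s (suc t) Q
  arith-seq refl a<W (reach run time≤ post) = reach (arith a<W ⨾ run) (s≤s time≤) post

  load-seq : ∀ {s x A y a P t Q} → mem s A (reg s y) ≡ a → a < W →
    Reach W P (setReg s x a) t Q → Reach W (load x A y ⨾ P) s (suc t) Q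
  load-seq refl a<W (reach run time≤ post) = reach (load a<W ⨾ run) (s≤s time≤) post

  store-rule : ∀ {s A x y i a} {Q : State → Set} → reg s x ≡ i → reg s y ≡ a → a < W →
    Q (setMem s A i a) → Reach W (store A x y) s 1 Q
  store-rule refl refl a<W post = reach (store a<W) ≤-refl post

  store-seq : ∀ {s A x y i a P t Q} → reg s x ≡ i → reg s y ≡ a → a < W →
    Reach W P (setMem s A i a) t Q → Reach W (store A x y ⨾ P) s (suc t) Q
  store-seq refl refl a<W (reach run time≤ post) = reach (store a<W ⨾ run) (s≤s time≤) post

  ifnz-rule : ∀ {s x P P′ t Q} → (reg s x ≢ 0 → Reach W P s t Q) → (reg s x ≡ 0 → Reach W P′ s t Q) →
    Reach W (ifnz x P P′) s (suc t) Q
  ifnz-rule {s} {x} nz z with reg s x ≟ 0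
  ... | yes eq with z eq
  ...   | reach run time≤ post = reach (ifnz-false eq run) (s≤s time≤) post
  ifnz-rule {s} {x} nz z | no neq with nz neq
  ...   | reach run time≤ post = reach (ifnz-true neq run) (s≤s time≤) post

  -- The invariant I φ carries a potential φ that pays for the rest of the loop.
  while-rule : ∀ {x P s φ} (I : ℕ → State → Set) → (∀ {φ s′} → I φ s′ → 1 ≤ φ) →
    (∀ {φ s′} → Agree P s s′ → I φ s′ → reg s′ x ≢ 0 →
      ∃₂ λ φ′ δ → 1 + (δ + φ′) ≤ φ × Reach W P s′ δ (I φ′)) →
    I φ s → Reach W (while x P) s φ (λ s′ → reg s′ x ≡ 0 × ∃ λ φ′ → I φ′ s′)
  while-rule {x} {P} {s} {φ} I positive body inv = loop φ ≤-refl agree-refl inv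
    where
    -- Each iteration spends at least one unit, so a bound on the potential is also the termination
    -- measure. `positive` keeps a unit for the final failing test.
    loop : ∀ fuel {φ s′} → φ ≤ fuel → Agree P s s′ → I φ s′ →
      Reach W (while x P) s′ φ (λ s″ → reg s″ x ≡ 0 × ∃ λ φ′ → I φ′ s″)
    loop zero φ≤0 _ inv = ⊥-elim (<⇒≱ (positive inv) φ≤0)
    loop (suc fuel) {φ} {s′} φ≤ agr inv with reg s′ x ≟ 0
    ... | yes eq = reach (while-false eq) (positive inv) (eq , φ , inv)
    ... | no neq with body agr inv neq
    ...   | φ′ , δ , cost , reach run time≤ post
      with loop fuel (≤-pred (≤-trans (s≤s (m≤n+m φ′ δ)) (≤-trans cost φ≤))) (agree-trans agr (run⇒agree run)) post
    ...     | reach run′ time≤′ post′ =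
      reach (while-true neq run run′) (≤-trans (s≤s (+-mono-≤ time≤ time≤′)) cost) post′

-- Counting loops: register i runs up to register e, which the body may move;
-- register r holds the number of iterations still to do.

test : Reg → Reg → Reg → Program
test i e r = arith r monus e i

next : Reg → Reg → Reg → Reg → Program
next one i e r = arith i add i one ⨾ test i e r

upto : Reg → Reg → Reg → Reg → Program → Program
upto one i e r P = test i e r ⨾ while r (P ⨾ next one i e r)

tested : Reg → Reg → Reg → State → State
tested i e r s = setReg s r (reg s e ∸ reg s i)

advanced : Reg → Reg → Reg → Reg → State → State
advanced one i e r s = tested i e r (setReg s i (reg s i + reg s one))

module _ {W : ℕ} where

  -- The invariant is taken after each `test`, hence on `tested` and `advanced` states. Besides the
  -- body an iteration costs 3: the loop test, the increment and the recomputation of `r`. The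
  -- register `e` may change, as the tail of the queue does.
  upto-rule : ∀ {one i e r P s φ} → r ≢ i → r ≢ e → (I : ℕ → State → Set) → (∀ {φ s′} → I φ s′ → 1 ≤ φ) →
    reg s e < W →
    (∀ {φ s′} → Agree (upto one i e r P) s s′ → I φ s′ → reg s′ i < reg s′ e →
      ∃₂ λ φ′ δ → 3 + (δ + φ′) ≤ φ × Reach W P s′ δ (λ s″ →
        reg s″ i + reg s″ one < W × reg (setReg s″ i (reg s″ i + reg s″ one)) e < W × I φ′ (advanced one i e r s″))) →
    I φ (tested i e r s) →
    Reach W (upto one i e r P) s (1 + φ) (λ s′ → reg s′ e ≤ reg s′ i × ∃ λ φ′ → I φ′ s′)
  upto-rule {one} {i} {e} {r} {P} {s} {φ} r≢i r≢e I positive e<W body inv =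
    arith-seq refl (≤-<-trans (m∸n≤m (reg s e) (reg s i)) e<W) (weaken ≤-refl finish
      (while-rule J (λ (inv , _) → positive inv) step (inv , counts s)))
    where
    J : ℕ → State → Set
    J φ s′ = I φ s′ × reg s′ r ≡ reg s′ e ∸ reg s′ i

    counts : ∀ s → reg (tested i e r s) r ≡ reg (tested i e r s) e ∸ reg (tested i e r s) i
    counts s = trans (update-same (reg s) r _)
      (sym (cong₂ _∸_ (update-other (reg s) _ r≢e) (update-other (reg s) _ r≢i)))

    finish : ∀ {s₁ s′} → Agree (while r (P ⨾ next one i e r)) s₁ s′ → reg s′ r ≡ 0 × (∃ λ φ′ → J φ′ s′) →
      reg s′ e ≤ reg s′ i × ∃ λ φ′ → I φ′ s′
    finish _ (eq , φ′ , inv , count) = m∸n≡0⇒m≤n (trans (sym count) eq) , φ′ , inv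

    tested-agree : Agree (test i e r) s (tested i e r s)
    tested-agree = run⇒agree {W = suc (reg s e ∸ reg s i)} (arith ≤-refl)

    step : ∀ {φ s′} → Agree (P ⨾ next one i e r) (tested i e r s) s′ → J φ s′ → reg s′ r ≢ 0 →
      ∃₂ λ φ′ δ → 1 + (δ + φ′) ≤ φ × Reach W (P ⨾ next one i e r) s′ δ (J φ′)
    step {φ} {s′} agr (inv , count) r≢0 with body (record
        { regs = λ x eq → trans (regs agr x (∨-conicalʳ (writesReg (test i e r) x) _ eq))
                                (regs tested-agree x (∨-conicalˡ (writesReg (test i e r) x) _ eq))
        ; arrs = arrs agr })
        inv (m∸n≢0⇒n<m (λ eq → r≢0 (trans count eq)))
    ... | φ′ , δ , cost , body-reach = φ′ , δ + 2 , ≤-trans (≤-reflexive (rearrange δ φ′)) cost ,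
      (body-reach ▷ λ s″ _ (i<W , e<W , inv′) → arith-seq refl i<W (arith-rule refl
        (≤-<-trans (m∸n≤m _ (reg (setReg s″ i (reg s″ i + reg s″ one)) i)) e<W) (inv′ , counts (setReg s″ i (reg s″ i + reg s″ one)))))
      where
      rearrange : ∀ δ φ′ → 1 + ((δ + 2) + φ′) ≡ 3 + (δ + φ′)
      rearrange = solve-∀

  -- The case of a fixed end, where the potential is determined by the counter. The 2 pays for the
  -- initial `test` and the last check of the loop.
  count-rule : ∀ {one i e r P s} → r ≢ i → writesReg P i ≡ false →
    writesReg (upto one i e r P) e ≡ false → writesReg (upto one i e r P) one ≡ false →
    (I : ℕ → State → Set) → ∀ {a b} δ → reg s i ≡ a → reg s e ≡ b → reg s one ≡ 1 → a ≤ b → b < W →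
    (∀ {j s′} → Agree (upto one i e r P) s s′ → a ≤ j → j < b → reg s′ i ≡ j → I j s′ →
      Reach W P s′ δ (λ s″ → I (suc j) (advanced one i e r s″))) →
    I a (tested i e r s) →
    Reach W (upto one i e r P) s (2 + (b ∸ a) * (3 + δ)) (I b)
  count-rule {one} {i} {e} {r} {P} {s} r≢i i-kept e-kept one-kept I {a} {b} δ i≡a e≡b one≡1 a≤b b<W body inv =
    weaken ≤-refl finish (upto-rule r≢i (does-false⇒≢ {r} {e} (∨-conicalˡ (does (r ≟ e)) _ e-kept)) J positive (subst (_< W) (sym e≡b) b<W) step
      (a , trans (update-other (reg s) _ r≢i) i≡a , ≤-refl , a≤b , refl , inv))
    where
    rest : ∀ x → writesReg (upto one i e r P) x ≡ false → writesReg P x ≡ false × does (i ≟ x) ≡ false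
    rest x eq = ∨-conicalˡ (writesReg P x) _ eq′ , ∨-conicalˡ (does (i ≟ x)) _ (∨-conicalʳ (writesReg P x) _ eq′)
      where
      eq′ : writesReg (P ⨾ next one i e r) x ≡ false
      eq′ = ∨-conicalʳ (does (r ≟ x)) _ eq

    J : ℕ → State → Set
    J φ s′ = ∃ λ j → reg s′ i ≡ j × a ≤ j × j ≤ b × φ ≡ 1 + (b ∸ j) * (3 + δ) × I j s′

    positive : ∀ {φ s′} → J φ s′ → 1 ≤ φ
    positive (_ , _ , _ , _ , refl , _) = s≤s z≤n

    finish : ∀ {s′} → Agree (upto one i e r P) s s′ → reg s′ e ≤ reg s′ i × (∃ λ φ → J φ s′) → I b s′
    finish {s′} agr (e≤i , _ , _ , i≡j , _ , upper , _ , holds) = subst (λ j → I j s′)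
      (≤-antisym upper (subst₂ _≤_ (trans (regs agr e e-kept) e≡b) i≡j e≤i)) holds

    step : ∀ {φ s′} → Agree (upto one i e r P) s s′ → J φ s′ → reg s′ i < reg s′ e →
      ∃₂ λ φ′ δ → 3 + (δ + φ′) ≤ φ × Reach W P s′ δ (λ s″ →
        reg s″ i + reg s″ one < W × reg (setReg s″ i (reg s″ i + reg s″ one)) e < W × J φ′ (advanced one i e r s″))
    step {φ} {s′} agr (j , i≡j , lower , _ , refl , holds) i<e =
      1 + (b ∸ suc j) * (3 + δ) , δ , cost , weaken ≤-refl conclude (body agr lower j<b i≡j holds)
      where
      e≡b′ : reg s′ e ≡ b
      e≡b′ = trans (regs agr e e-kept) e≡b

      j<b : j < b
      j<b = subst₂ _<_ i≡j e≡b′ i<e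

      cost : 3 + (δ + (1 + (b ∸ suc j) * (3 + δ))) ≤ 1 + (b ∸ j) * (3 + δ)
      cost = ≤-reflexive (trans (cong (3 +_) (+-suc δ _))
        (cong (λ z → 1 + z * (3 + δ)) (sym (+-∸-assoc 1 j<b))))

      conclude : ∀ {s″} → Agree P s′ s″ → I (suc j) (advanced one i e r s″) →
        reg s″ i + reg s″ one < W × reg (setReg s″ i (reg s″ i + reg s″ one)) e < W ×
        J (1 + (b ∸ suc j) * (3 + δ)) (advanced one i e r s″)
      conclude {s″} agr′ holds′ =
        subst (_< W) (sym i′≡) (≤-<-trans j<b b<W) ,
        subst (_< W) (sym e″≡) b<W ,
        (suc j , trans (update-other _ _ r≢i) (trans (update-same (reg s″) i _) i′≡) ,
          m≤n⇒m≤1+n lower , j<b , refl , holds′)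
        where
        i′≡ : reg s″ i + reg s″ one ≡ suc j
        i′≡ = trans (cong₂ _+_ (trans (regs agr′ i i-kept) i≡j)
          (trans (regs agr′ one (proj₁ (rest one one-kept))) (trans (regs agr one one-kept) one≡1))) (+-comm j 1)

        e″≡ : reg (setReg s″ i (reg s″ i + reg s″ one)) e ≡ b
        e″≡ = trans (update-unwritten (reg s″) i _ e (proj₂ (rest e e-kept)))
          (trans (regs agr′ e (proj₁ (rest e e-kept))) e≡b′)

-- Lists in memory

-- An inductive form of the field `item`: it follows the list, so appending and splitting become
-- inductions without arithmetic on `Fin` indices.
data Segment {n} (f : ℕ → ℕ) : ℕ → List (Fin n) → Set where
  []  : ∀ {a} → Segment f a []
  _∷_ : ∀ {a x xs} → f a ≡ toℕ x → Segment f (suc a) xs → Segment f a (x ∷ xs)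

module _ {n : ℕ} where

  Segment⇒lookup : ∀ {f a} {xs : List (Fin n)} → Segment f a xs → ∀ j → f (a + toℕ j) ≡ toℕ (lookup xs j)
  Segment⇒lookup {f} {a} (eq ∷ seg) zero    = trans (cong f (+-identityʳ a)) eq
  Segment⇒lookup {f} {a} (eq ∷ seg) (suc j) = trans (cong f (+-suc a (toℕ j))) (Segment⇒lookup seg j)

  lookup⇒Segment : ∀ {f a} (xs : List (Fin n)) → (∀ j → f (a + toℕ j) ≡ toℕ (lookup xs j)) → Segment f a xs
  lookup⇒Segment []       eqs = []
  lookup⇒Segment {f} {a} (x ∷ xs) eqs = trans (cong f (sym (+-identityʳ a))) (eqs zero)
    ∷ lookup⇒Segment xs λ j → trans (cong f (sym (+-suc a (toℕ j)))) (eqs (suc j))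

  Segment-at : ∀ {f a} (xs : List (Fin n)) {y ys} → Segment f a (xs ++ y ∷ ys) → f (a + length xs) ≡ toℕ y
  Segment-at {f} {a} []       (eq ∷ _)  = trans (cong f (+-identityʳ a)) eq
  Segment-at {f} {a} (x ∷ xs) (_ ∷ seg) = trans (cong f (+-suc a (length xs))) (Segment-at xs seg)

  Segment-cong : ∀ {f g a b} {xs : List (Fin n)} → (∀ p → p < b → g p ≡ f p) → a + length xs ≤ b →
    Segment f a xs → Segment g a xs
  Segment-cong agree a≤b []         = []
  Segment-cong {a = a} agree a≤b (_∷_ {xs = xs} eq seg) =
    trans (agree a (≤-trans (s≤s (m≤m+n a _)) 1+a≤b)) eq ∷ Segment-cong agree 1+a≤b seg
    where
    1+a≤b = ≤-trans (≤-reflexive (sym (+-suc a (length xs)))) a≤b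

  Segment-snoc : ∀ {f a} (xs : List (Fin n)) {y} → Segment f a xs → f (a + length xs) ≡ toℕ y → Segment f a (xs ∷ʳ y)
  Segment-snoc {f} {a} []       []         eq = trans (cong f (sym (+-identityʳ a))) eq ∷ []
  Segment-snoc {f} {a} (x ∷ xs) (eq′ ∷ seg) eq =
    eq′ ∷ Segment-snoc xs seg (trans (cong f (sym (+-suc a (length xs)))) eq)

∈-∷ʳ⁻ : ∀ {A : Set} (xs : List A) {x y} → y ∈ᴸ xs ∷ʳ x → y ∈ᴸ xs ⊎ y ≡ x
∈-∷ʳ⁻ xs y∈ with ∈-++⁻ xs y∈
... | inj₁ y∈xs        = inj₁ y∈xs
... | inj₂ (here refl) = inj₂ refl

Unique-∷ʳ : ∀ {A : Set} {xs : List A} {x} → Unique xs → ¬ (x ∈ᴸ xs) → Unique (xs ∷ʳ x)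
Unique-∷ʳ uniq x∉ = Uniqueₚ.++⁺ uniq ([] ∷ []) λ { (x∈ , here refl) → x∉ x∈ }

∈-map-proj₁⁻ : ∀ {A B : Set} {xs : List (A × B)} {a} → a ∈ᴸ map proj₁ xs → ∃ λ b → (a , b) ∈ᴸ xs
∈-map-proj₁⁻ a∈ with ∈-map⁻ proj₁ a∈
... | (_ , b) , ab∈ , refl = b , ab∈

length-∷ʳ : ∀ {A : Set} (xs : List A) x → length (xs ∷ʳ x) ≡ suc (length xs)
length-∷ʳ xs x = trans (length-++ xs) (+-comm (length xs) 1)

module _ {s : State} {start items : Arr} {r n} {F : Fin r → Subset n} (stored : StoresFamily s start items F) where

  open StoresFamily stored

  Segment-item : ∀ i → Segment (mem s items) (mem s start (toℕ i)) (list i)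
  Segment-item i = lookup⇒Segment (list i) (item i)

  -- Each list is free of repetitions, so it has at most `n` entries. This bounds all positions by a
  -- product of two size parameters and lets them fit into a word.
  start≤ : ∀ k → k ≤ r → mem s start k ≤ k * n
  start≤ zero    _   = ≤-reflexive start-zero
  start≤ (suc k) k<r = begin
    mem s start (suc k)                ≡⟨ cong (mem s start ∘ suc) (toℕ-fromℕ< k<r) ⟨
    mem s start (suc (toℕ i))          ≡⟨ start-suc i ⟩
    mem s start (toℕ i) + length (list i) ≡⟨ cong (λ j → mem s start j + length (list i)) (toℕ-fromℕ< k<r) ⟩
    mem s start k + length (list i)    ≤⟨ +-mono-≤ (start≤ k (<⇒≤ k<r)) (Unique-length≤n (unique i)) ⟩
    k * n + n                          ≡⟨ +-comm (k * n) n ⟩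
    suc k * n                          ∎
    where
    open ≤-Reasoning hiding (start)
    i = fromℕ< k<r

  family-transport : ∀ {s′} → mem s′ start ≡ mem s start → mem s′ items ≡ mem s items → StoresFamily s′ start items F
  family-transport {s′} start≡ items≡ = record
    { list       = list
    ; unique     = unique
    ; members    = members
    ; start-zero = subst (λ f → f 0 ≡ 0) (sym start≡) start-zero
    ; start-suc  = λ i → subst (λ f → f (suc (toℕ i)) ≡ f (toℕ i) + length (list i)) (sym start≡) (start-suc i)
    ; item       = λ i j → subst₂ (λ f g → g (f (toℕ i) + toℕ j) ≡ toℕ (lookup (list i) j)) (sym start≡) (sym items≡) (item i j)
    }

-- Array 8 serves as the queue of the search and array 10 holds, for a
-- vertex at distance l ≤ d from the bag, the number 1+d−l, and 0 for other vertices.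

rOne rWidth rTop rVertex rTodo₁ rLayer rBag rZero rTail rTodo₂ rHead rPos rEnd rTodo₃ rItem rLevel rTodo₄ rCurrent rMark : Reg
rOne     = 5
rWidth   = 6
rTop     = 7
rVertex  = 8
rTodo₁   = 9
rLayer   = 10
rBag     = 11
rZero    = 12
rTail    = 13
rTodo₂   = 14
rHead    = 15
rPos     = 16
rEnd     = 17
rTodo₃   = 18
rItem    = 19
rLevel   = 20
rTodo₄   = 21
rCurrent = 22
rMark    = 23

push : Program
push = store 10 rItem rLevel ⨾ store 8 rTail rItem ⨾ arith rTail add rTail rOne

scan : Arr → Program
scan A = upto rOne rPos rEnd rTodo₃ (load rItem A rPos ⨾ load rMark 10 rItem ⨾ ifnz rMark skip push)

-- The mark lowered by one is the mark for newly found neighbours. If it is 0, the vertex lies at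
-- depth `d` and is not expanded; no comparison with `d` takes place.
visit : Program
visit =
  load rCurrent 8 rHead ⨾ load rLevel 10 rCurrent ⨾ arith rLevel monus rLevel rOne ⨾
  ifnz rLevel (load rPos 0 rCurrent ⨾ arith rEnd add rCurrent rOne ⨾ load rEnd 0 rEnd ⨾ scan 1) skip

visitAll : Program
visitAll = upto rOne rHead rTail rTodo₄ visit

-- Run before every search: array 10 has arbitrary contents at first and later holds the marks of
-- the previous search.
clear : Program
clear = upto rOne rVertex 0 rTodo₁ (store 10 rVertex rZero)

-- `rTail` carries over from bag to bag. The queue starts where the previous list ended, and once
-- exhausted it is the list of the new bag, in its final place.
searchBag : Program
searchBag =
  const rVertex 0 ⨾ clear ⨾
  arith rHead add rTail rZero ⨾ load rPos 4 rBag ⨾ arith rEnd add rBag rOne ⨾ load rEnd 4 rEnd ⨾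
  arith rLevel add rTop rZero ⨾ scan 5 ⨾ visitAll ⨾
  arith rEnd add rBag rOne ⨾ store 7 rEnd rTail

searchAll : Program
searchAll = upto rOne rBag 1 rTodo₂ searchBag

assignLayer : Program
assignLayer = load rLayer 6 rVertex ⨾ arith rLayer quot rLayer rWidth ⨾ store 9 rVertex rLayer

assignLayers : Program
assignLayers = upto rOne rVertex 0 rTodo₁ assignLayer

main : Program
main =
  const rOne 1 ⨾ const rZero 0 ⨾ arith rTop add 3 rOne ⨾
  -- Here `rWidth` is still 2d, so register 4 receives m+2d, the numerator of the ceiling; only
  -- afterwards is `rWidth` raised to the divisor 1+2d.
  arith rWidth add 3 3 ⨾ arith 4 add 2 rWidth ⨾ arith rWidth add rWidth rOne ⨾ arith 4 quot 4 rWidth ⨾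
  const rVertex 0 ⨾ assignLayers ⨾
  const rBag 0 ⨾ const rTail 0 ⨾ store 7 rBag rTail ⨾ searchAll

-- The queue, and scanning a list of vertices into it

module Search (W : ℕ) {n : ℕ} (base : ℕ) (before : ℕ → ℕ) (base+n<W : base + n < W) where

  Entry : Set
  Entry = Fin n × ℕ

  vertices : List Entry → List (Fin n)
  vertices = map proj₁

  -- `cells` and `marks` are arrays 8 and 10, and `before` is array 8 when the search begins;
  -- `below` protects the lists of earlier bags. By `mark` and `listed` the vertices with nonzero
  -- mark are exactly the queued ones. Speaking of these three components instead of a state makes
  -- the record indifferent to changes of other registers.
  record Queue (tail : ℕ) (cells marks : ℕ → ℕ) (Q : List Entry) : Set where
    field
      tail≡    : tail ≡ base + length Q
      segment  : Segment cells base (vertices Q)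
      unique   : Unique (vertices Q)
      mark     : ∀ {v r} → (v , r) ∈ᴸ Q → marks (toℕ v) ≡ r × r ≢ 0 × r < W
      listed   : ∀ {v} → marks (toℕ v) ≢ 0 → v ∈ᴸ vertices Q
      below    : ∀ p → p < base → cells p ≡ before p

    length≤n : length Q ≤ n
    length≤n = ≤-trans (≤-reflexive (sym (length-map proj₁ Q))) (Unique-length≤n unique)

    tail<W : tail < W
    tail<W = ≤-<-trans (≤-trans (≤-reflexive tail≡) (+-monoʳ-≤ base length≤n)) base+n<W

    mark<W : ∀ v → marks (toℕ v) < W
    mark<W v with marks (toℕ v) ≟ 0
    ... | yes eq = subst (_< W) (sym eq) (≤-<-trans z≤n base+n<W)
    ... | no neq with ∈-map-proj₁⁻ (listed {v} neq)
    ...   | r , vr∈ = let eq , _ , r<W = mark vr∈ in subst (_< W) (sym eq) r<W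

  open Queue

  emptyQueue : ∀ {tail cells marks} → tail ≡ base → (∀ p → p < base → cells p ≡ before p) →
    (∀ (v : Fin n) → marks (toℕ v) ≡ 0) → Queue tail cells marks []
  emptyQueue tail≡base below blank = record
    { tail≡    = trans tail≡base (sym (+-identityʳ base))
    ; segment  = []
    ; unique   = []
    ; mark     = λ ()
    ; listed   = λ {v} neq → contradiction (blank v) neq
    ; below    = below
    }

  Queue-push : ∀ {tail cells marks Q w level} → Queue tail cells marks Q → marks (toℕ w) ≡ 0 → level ≢ 0 → level < W →
    Queue (suc tail) (update cells tail (toℕ w)) (update marks (toℕ w) level) (Q ∷ʳ (w , level))
  Queue-push {tail} {cells} {marks} {Q} {w} {level} queue blank level≢0 level<W = record
    { tail≡    = trans (cong suc (tail≡ queue)) (trans (sym (+-suc base (length Q))) (cong (base +_) (sym (length-∷ʳ Q _))))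
    ; segment  = subst (Segment _ base) (sym vertices-∷ʳ) (Segment-snoc (vertices Q)
        (Segment-cong cells-kept (≤-reflexive (sym tail≡′)) (segment queue))
        (trans (cong (update cells tail (toℕ w)) (sym tail≡′)) (update-same cells tail (toℕ w))))
    ; unique   = subst Unique (sym vertices-∷ʳ) (Unique-∷ʳ (unique queue) w∉)
    ; mark     = mark′
    ; listed   = listed′
    ; below    = λ p p<base → trans (cells-kept p (≤-trans p<base (≤-trans (m≤m+n base _) (≤-reflexive (sym (tail≡ queue))))))
                                    (below queue p p<base)
    }
    where
    vertices-∷ʳ : vertices (Q ∷ʳ (w , level)) ≡ vertices Q ∷ʳ w
    vertices-∷ʳ = map-++ proj₁ Q _

    tail≡′ : tail ≡ base + length (vertices Q)
    tail≡′ = trans (tail≡ queue) (cong (base +_) (sym (length-map proj₁ Q)))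

    cells-kept : ∀ p → p < tail → update cells tail (toℕ w) p ≡ cells p
    cells-kept p p<tail = update-other cells _ (λ eq → <⇒≢ p<tail (sym eq))

    w∉ : ¬ (w ∈ᴸ vertices Q)
    w∉ w∈ with ∈-map-proj₁⁻ w∈
    ... | r , wr∈ = let eq , r≢0 , _ = mark queue wr∈ in r≢0 (trans (sym eq) blank)

    mark′ : ∀ {v r} → (v , r) ∈ᴸ Q ∷ʳ (w , level) → update marks (toℕ w) level (toℕ v) ≡ r × r ≢ 0 × r < W
    mark′ vr∈ with ∈-∷ʳ⁻ Q vr∈
    ... | inj₂ refl = update-same marks (toℕ w) level , level≢0 , level<W
    ... | inj₁ vr∈Q = let eq , r≢0 , r<W = mark queue vr∈Q in
      trans (update-other marks level λ same → w∉ (subst (_∈ᴸ vertices Q) (sym (toℕ-injective same)) (∈-map⁺ proj₁ vr∈Q))) eq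
      , r≢0 , r<W

    listed′ : ∀ {v} → update marks (toℕ w) level (toℕ v) ≢ 0 → v ∈ᴸ vertices (Q ∷ʳ (w , level))
    listed′ {v} neq with w ≟ᶠ v
    ... | yes refl = subst (w ∈ᴸ_) (sym vertices-∷ʳ) (∈-++⁺ʳ (vertices Q) (here refl))
    ... | no  w≢v  = subst (v ∈ᴸ_) (sym vertices-∷ʳ) (∈-++⁺ˡ (listed queue
      λ eq → neq (trans (update-other marks level (w≢v ∘ toℕ-injective)) eq)))

  QueueAt : State → List Entry → Set
  QueueAt s = Queue (reg s rTail) (mem s 8) (mem s 10)

  at : ℕ → List (Fin n) → List Entry
  at level = map (_, level)

  record Scanned (xs : List (Fin n)) (level : ℕ) (Q : List Entry) (tail : ℕ) (cells marks : ℕ → ℕ) : Set where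
    field
      {new}    : List (Fin n)
      queue    : Queue tail cells marks (Q ++ at level new)
      new⊆     : ∀ {v} → v ∈ᴸ new → v ∈ᴸ xs
      complete : ∀ {v} → v ∈ᴸ xs → v ∈ᴸ vertices (Q ++ at level new)

  module _ {A : Arr} (A-kept : writesArr (scan A) A ≡ false) {s : State} {xs : List (Fin n)} {level : ℕ} {Q : List Entry}
    (one : reg s rOne ≡ 1) (from : reg s rEnd ≡ reg s rPos + length xs) (end<W : reg s rEnd < W)
    (level≡ : reg s rLevel ≡ level) (level≢0 : level ≢ 0) (level<W : level < W)
    (stored : Segment (mem s A) (reg s rPos) xs) (queue₀ : QueueAt s Q) where

    private
      start : ℕ
      start = reg s rPos

      record Scanning (j tail : ℕ) (cells marks : ℕ → ℕ) : Set where
        field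
          {done todo new} : List (Fin n)
          split    : xs ≡ done ++ todo
          position : j ≡ start + length done
          queue    : Queue tail cells marks (Q ++ at level new)
          new⊆     : ∀ {v} → v ∈ᴸ new → v ∈ᴸ xs
          complete : ∀ {v} → v ∈ᴸ done → v ∈ᴸ vertices (Q ++ at level new)

      I : ℕ → State → Set
      I j s′ = Scanning j (reg s′ rTail) (mem s′ 8) (mem s′ 10)

      vertex<W : ∀ (x : Fin n) → toℕ x < W
      vertex<W x = <-≤-trans (toℕ<n x) (≤-trans (m≤n+m n base) (<⇒≤ base+n<W))

      body : ∀ {j s′} → Agree (scan A) s s′ → start ≤ j → j < start + length xs → reg s′ rPos ≡ j → I j s′ →
        Reach W (load rItem A rPos ⨾ load rMark 10 rItem ⨾ ifnz rMark skip push) s′ 6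
          (λ s″ → I (suc j) (advanced rOne rPos rEnd rTodo₃ s″))
      body agr _ j<end pos record { done = done ; todo = [] ; split = split ; position = refl } =
        ⊥-elim (<-irrefl (cong (λ ys → start + length ys) (sym (trans split (++-identityʳ done)))) j<end)
      body {s′ = s′} agr _ j<end pos record { done = done ; todo = x ∷ todo ; new = new ; split = split ; position = refl ; queue = queue ; new⊆ = new⊆ ; complete = complete } =
        load-seq item (vertex<W x) (load-seq refl (mark<W queue x) (ifnz-rule
          -- A marked vertex is in the queue already, by `listed`. The time of `skip` is padded to
          -- that of `push`.
          (λ marked → weaken (s≤s z≤n) (λ _ inv → inv) (skip-rule (record
            { done     = done ∷ʳ x
            ; todo     = todo
            ; split    = split′
            ; position = position′
            ; queue    = queue
            ; new⊆     = new⊆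
            ; complete = λ v∈ → [ complete , (λ { refl → listed queue marked }) ]′ (∈-∷ʳ⁻ done v∈)
            })))
          (λ blank → store-seq refl level-now level<W (store-seq refl refl (vertex<W x)
            (arith-rule (trans (cong (reg s′ rTail +_) one-now) (+-comm _ 1)) (tail<W (pushed blank)) (record
            { done     = done ∷ʳ x
            ; todo     = todo
            ; new      = new ∷ʳ x
            ; split    = split′
            ; position = position′
            ; queue    = pushed blank
            ; new⊆     = λ v∈ → [ new⊆ , (λ { refl → x∈ }) ]′ (∈-∷ʳ⁻ new v∈)
            ; complete = λ v∈ → subst (λ Q′ → _ ∈ᴸ vertices Q′) reassociate
                (subst (_ ∈ᴸ_) (sym (map-++ proj₁ (Q ++ at level new) _))
                  ([ ∈-++⁺ˡ ∘ complete , (λ { refl → ∈-++⁺ʳ (vertices (Q ++ at level new)) (here refl) }) ]′ (∈-∷ʳ⁻ done v∈)))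
            }))))))
        where
        item : mem s′ A (reg s′ rPos) ≡ toℕ x
        item = trans (cong₂ (λ f p → f p) (arrs agr A A-kept) pos)
          (Segment-at done (subst (Segment (mem s A) start) split stored))

        level-now : reg s′ rLevel ≡ level
        level-now = trans (regs agr rLevel refl) level≡

        one-now : reg s′ rOne ≡ 1
        one-now = trans (regs agr rOne refl) one

        split′ : xs ≡ (done ∷ʳ x) ++ todo
        split′ = trans split (sym (++-assoc done (x ∷ []) todo))

        position′ : suc (start + length done) ≡ start + length (done ∷ʳ x)
        position′ = trans (sym (+-suc start (length done))) (cong (start +_) (sym (length-∷ʳ done x)))

        x∈ : x ∈ᴸ xs
        x∈ = subst (x ∈ᴸ_) (sym split) (∈-++⁺ʳ done (here refl))

        reassociate : (Q ++ at level new) ∷ʳ (x , level) ≡ Q ++ at level (new ∷ʳ x)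
        reassociate = trans (++-assoc Q _ _) (cong (Q ++_) (sym (map-++ (_, level) new (x ∷ []))))

        pushed : mem s′ 10 (toℕ x) ≡ 0 → Queue (suc (reg s′ rTail)) (update (mem s′ 8) (reg s′ rTail) (toℕ x))
          (update (mem s′ 10) (toℕ x) level) (Q ++ at level (new ∷ʳ x))
        pushed blank = subst (Queue _ _ _) reassociate (Queue-push queue blank level≢0 level<W)

    -- An entry costs 9: 3 for the loop, 2 loads, the branch, and 3 for `push`.
    scan-correct : Reach W (scan A) s (2 + length xs * 9) (λ s′ → Scanned xs level Q (reg s′ rTail) (mem s′ 8) (mem s′ 10))
    scan-correct = weaken (≤-reflexive (cong (λ k → 2 + k * 9) (m+n∸m≡n start (length xs)))) (λ _ → finish)
      (count-rule (λ ()) refl refl refl I 6 refl from one (m≤m+n start _) (subst (_< W) from end<W) body (record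
        { done     = []
        ; new      = []
        ; split    = refl
        ; position = sym (+-identityʳ start)
        ; queue    = subst (Queue _ _ _) (sym (++-identityʳ Q)) queue₀
        ; new⊆     = λ ()
        ; complete = λ ()
        }))
      where
      finish : ∀ {tail cells marks} → Scanning (start + length xs) tail cells marks → Scanned xs level Q tail cells marks
      finish record { done = done ; todo = [] ; split = split ; queue = queue ; new⊆ = new⊆ ; complete = complete } = record
        { queue = queue ; new⊆ = new⊆ ; complete = λ v∈ → complete (subst (_ ∈ᴸ_) (trans split (++-identityʳ done)) v∈) }
      finish record { done = done ; todo = x ∷ todo ; split = split ; position = position } = ⊥-elim (<-irrefl
        (trans (sym (+-cancelˡ-≡ start _ _ position)) (trans (cong length split) (length-++ done)))
        (m<m+n (length done) z<s))

-- Arcs and the total cost of scanning them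

module Arcs {n} (G : Graph n) (adjacent : Fin n → List (Fin n)) (unique : ∀ u → Unique (adjacent u))
  (adjacent⇒Adj : ∀ u {v} → v ∈ᴸ adjacent u → Adj G u v) where

  arcs : List (Fin n) → List (Fin n × Fin n)
  arcs = concatMap λ u → map (u ,_) (adjacent u)

  ∈-arcs⁻ : ∀ us {u v} → (u , v) ∈ᴸ arcs us → u ∈ᴸ us × v ∈ᴸ adjacent u
  ∈-arcs⁻ (w ∷ us) uv∈ with ∈-++⁻ (map (w ,_) (adjacent w)) uv∈
  ... | inj₂ uv∈us = let u∈ , v∈ = ∈-arcs⁻ us uv∈us in there u∈ , v∈
  ... | inj₁ uv∈w with ∈-map⁻ (w ,_) uv∈w
  ...   | v , v∈ , refl = here refl , v∈

  arcs-unique : ∀ {us} → Unique us → Unique (arcs us)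
  arcs-unique [] = []
  arcs-unique {u ∷ us} (u∉ ∷ uniq) = Uniqueₚ.++⁺ (Uniqueₚ.map⁺ (λ { refl → refl }) (unique u)) (arcs-unique uniq) disjoint
    where
    disjoint : ∀ {e} → ¬ (e ∈ᴸ map (u ,_) (adjacent u) × e ∈ᴸ arcs us)
    disjoint (e∈u , e∈us) with ∈-map⁻ (u ,_) e∈u
    ... | v , _ , refl = All.lookup u∉ (proj₁ (∈-arcs⁻ us e∈us)) refl

  edge-∈ : ∀ {u v} → u <ᶠ v → Adj G u v → (u , v) ∈ᴸ edges G
  edge-∈ {u} {v} u<v e = ∈-filter⁺ (λ (u , v) → (u <?ᶠ v) ×-dec adj? G u v)
    (∈-cartesianProduct⁺ (∈-allFin u) (∈-allFin v)) (u<v , e)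

  arc⇒edge : ∀ {u v} → Adj G u v → (u , v) ∈ᴸ edges G ++ map swap (edges G)
  arc⇒edge {u} {v} e with <-cmpᶠ u v
  ... | tri< u<v _ _  = ∈-++⁺ˡ (edge-∈ u<v e)
  ... | tri≈ _ refl _ = contradiction e (irrefl G)
  ... | tri> _ _ v<u  = ∈-++⁺ʳ (edges G) (∈-map⁺ swap (edge-∈ v<u (symm G e)))

  -- The handshake bound: `edges` lists an edge once, smaller end first, so each arc is an entry of
  -- it or a swapped entry.
  arcs≤ : ∀ {us} → Unique us → length (arcs us) ≤ 2 * ∣E G ∣
  arcs≤ {us} uniq = begin
    length (arcs us)                         ≤⟨ Unique-⊆⇒length≤ (arcs-unique uniq)
      (λ {(u , v)} uv∈ → arc⇒edge (adjacent⇒Adj u (proj₂ (∈-arcs⁻ us uv∈)))) ⟩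
    length (edges G ++ map swap (edges G))   ≡⟨ length-++ (edges G) ⟩
    ∣E G ∣ + length (map swap (edges G))     ≡⟨ cong (∣E G ∣ +_) (length-map swap (edges G)) ⟩
    ∣E G ∣ + ∣E G ∣                          ≡⟨ cong (∣E G ∣ +_) (+-identityʳ ∣E G ∣) ⟨
    2 * ∣E G ∣                               ∎
    where open ≤-Reasoning

  -- Per vertex 12: 3 for the loop of `visitAll` and 9 for `visit` apart from the scanned entries.
  -- Per arc 9, the price of one scanned entry.
  cost : List (Fin n) → ℕ
  cost us = length us * 12 + length (arcs us) * 9

  cost-++ : ∀ us vs → cost (us ++ vs) ≡ cost us + cost vs
  cost-++ us vs = trans (cong₂ (λ a b → a * 12 + b * 9) (length-++ us)
    (trans (cong length (concatMap-++ (λ u → map (u ,_) (adjacent u)) us vs)) (length-++ (arcs us))))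
    (rearrange (length us) (length vs) (length (arcs us)) (length (arcs vs)))
    where
    rearrange : ∀ a b c d → (a + b) * 12 + (c + d) * 9 ≡ a * 12 + c * 9 + (b * 12 + d * 9)
    rearrange = solve-∀

  cost-[_] : ∀ u → cost (u ∷ []) ≡ 12 + length (adjacent u) * 9
  cost-[ u ] = cong (λ k → 12 + k * 9)
    (trans (cong length (++-identityʳ (map (u ,_) (adjacent u)))) (length-map (u ,_) (adjacent u)))

  budget : ℕ
  budget = n * 12 + 2 * ∣E G ∣ * 9

  cost≤budget : ∀ {us} → Unique us → cost us ≤ budget
  cost≤budget uniq = +-mono-≤ (*-monoˡ-≤ 12 (Unique-length≤n uniq)) (*-monoˡ-≤ 9 (arcs≤ uniq))

-- Breadth-first search

module _ {n} (G : Graph n) (d : ℕ) (X : Subset n) where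

  -- An entry (v , r) records that v is at distance 1+d−r from X.
  record Explored (ps us : List (Fin n × ℕ)) : Set where
    field
      sound  : ∀ {v r} → (v , r) ∈ᴸ ps ++ us → ∃₂ λ x l → x ∈ X × Walk G l x v × l + r ≡ suc d
      roots  : ∀ {x} → x ∈ X → (x , suc d) ∈ᴸ ps ++ us
      -- `ps` holds the expanded entries and `us` the waiting ones. A mark of 1 is depth `d`, where
      -- the search stops; otherwise each neighbour is present, with a mark lower by at most one.
      closed : ∀ {u r} → (u , r) ∈ᴸ ps → r ≤ 1 ⊎ (∀ w → Adj G u w → ∃ λ r′ → (w , r′) ∈ᴸ ps ++ us × r ≤ suc r′)
      -- Together with `sorted` this is the breadth-first order: no waiting mark exceeds an expanded
      -- one, and the waiting marks do not increase and take at most two consecutive values.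
      ahead  : ∀ {a b} → a ∈ᴸ ps → b ∈ᴸ us → proj₂ b ≤ proj₂ a
      sorted : AllPairs (λ a b → proj₂ b ≤ proj₂ a × proj₂ a ≤ suc (proj₂ b)) us

  open Explored

  constant-sorted : ∀ r (vs : List (Fin n)) →
    AllPairs (λ a b → proj₂ b ≤ proj₂ a × proj₂ a ≤ suc (proj₂ b)) (map (_, r) vs)
  constant-sorted r []       = []
  constant-sorted r (v ∷ vs) = Allₚ.map⁺ (All.universal (λ _ → ≤-refl , n≤1+n r) vs) ∷ constant-sorted r vs

  explored-start : ∀ {vs} → (∀ {v} → v ∈ᴸ vs → v ∈ X) → (∀ {v} → v ∈ X → v ∈ᴸ vs) → Explored [] (map (_, suc d) vs)
  explored-start {vs} vs⊆X X⊆vs = record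
    { sound  = sound′
    ; roots  = λ x∈ → ∈-map⁺ (_, suc d) (X⊆vs x∈)
    ; closed = λ ()
    ; ahead  = λ ()
    ; sorted = constant-sorted (suc d) vs
    }
    where
    sound′ : ∀ {v r} → (v , r) ∈ᴸ map (_, suc d) vs → ∃₂ λ x l → x ∈ X × Walk G l x v × l + r ≡ suc d
    sound′ vr∈ with ∈-map⁻ (_, suc d) vr∈
    ... | v , v∈ , refl = v , 0 , vs⊆X v∈ , [] , refl

  explored-step : ∀ {ps us u level new} → Explored ps ((u , suc level) ∷ us) →
    (∀ {v} → v ∈ᴸ new → Adj G u v) →
    suc level ≤ 1 ⊎ (∀ w → Adj G u w → w ∈ᴸ map proj₁ ((ps ++ (u , suc level) ∷ us) ++ map (_, level) new)) →
    Explored (ps ∷ʳ (u , suc level)) (us ++ map (_, level) new)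
  explored-step {ps} {us} {u} {level} {new} ex new⊆ scanned = record
    { sound  = λ vr∈ → sound′ (∈-++⁻ Q (subst (_ ∈ᴸ_) (sym reassociate) vr∈))
    ; roots  = λ x∈ → old (roots ex x∈)
    ; closed = λ ur∈ → closed′ (∈-∷ʳ⁻ ps ur∈)
    ; ahead  = λ a∈ b∈ → ahead′ (∈-∷ʳ⁻ ps a∈) (∈-++⁻ us b∈)
    ; sorted = sorted′ (sorted ex)
    }
    where
    Q : List (Fin n × ℕ)
    Q = ps ++ (u , suc level) ∷ us

    reassociate : Q ++ map (_, level) new ≡ (ps ∷ʳ (u , suc level)) ++ us ++ map (_, level) new
    reassociate = trans (++-assoc ps _ _) (sym (++-assoc ps _ _))

    old : ∀ {a} → a ∈ᴸ Q → a ∈ᴸ (ps ∷ʳ (u , suc level)) ++ us ++ map (_, level) new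
    old a∈ = subst (_ ∈ᴸ_) reassociate (∈-++⁺ˡ a∈)

    u∈ : (u , suc level) ∈ᴸ Q
    u∈ = ∈-++⁺ʳ ps (here refl)

    -- `u` leads the queue, so every waiting mark is `suc level` or `level`; appending entries
    -- marked `level` therefore keeps the order.
    after : ∀ {a} → a ∈ᴸ us → proj₂ a ≤ suc level × level ≤ proj₂ a
    after a∈ with sorted ex
    ... | rel ∷ _ = let le , ge = All.lookup rel a∈ in le , ≤-pred ge

    sound′ : ∀ {v r} → (v , r) ∈ᴸ Q ⊎ (v , r) ∈ᴸ map (_, level) new → ∃₂ λ x l → x ∈ X × Walk G l x v × l + r ≡ suc d
    sound′ (inj₁ vr∈) = sound ex vr∈
    sound′ (inj₂ vr∈) with ∈-map⁻ (_, level) vr∈ | sound ex u∈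
    ... | v , v∈ , refl | x , l , x∈ , w , eq = x , suc l , x∈ , snoc w (new⊆ v∈) , trans (sym (+-suc l level)) eq

    closed′ : ∀ {v r} → (v , r) ∈ᴸ ps ⊎ (v , r) ≡ (u , suc level) → r ≤ 1 ⊎
      (∀ w → Adj G v w → ∃ λ r′ → (w , r′) ∈ᴸ (ps ∷ʳ (u , suc level)) ++ us ++ map (_, level) new × r ≤ suc r′)
    closed′ (inj₁ vr∈) with closed ex vr∈
    ... | inj₁ r≤1 = inj₁ r≤1
    ... | inj₂ nbs = inj₂ λ w e → let r′ , wr∈ , r≤ = nbs w e in r′ , old wr∈ , r≤
    closed′ (inj₂ refl) = Sum.map₂ neighbours scanned
      where
      -- Here the breadth-first order is used: a neighbour found earlier is an expanded or a waiting
      -- entry, so its mark is at least `level`, the mark that `u` would give it.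
      near : ∀ {w r′} → (w , r′) ∈ᴸ Q ⊎ (w , r′) ∈ᴸ map (_, level) new → suc level ≤ suc r′
      near (inj₂ wr∈) with ∈-map⁻ (_, level) wr∈
      ... | _ , _ , refl = ≤-refl
      near (inj₁ wr∈) with ∈-++⁻ ps wr∈
      ... | inj₁ wr∈ps        = m≤n⇒m≤1+n (ahead ex wr∈ps (here refl))
      ... | inj₂ (here refl)  = n≤1+n _
      ... | inj₂ (there wr∈) = s≤s (proj₂ (after wr∈))

      neighbours : (∀ w → Adj G u w → w ∈ᴸ map proj₁ (Q ++ map (_, level) new)) → ∀ w → Adj G u w →
        ∃ λ r′ → (w , r′) ∈ᴸ (ps ∷ʳ (u , suc level)) ++ us ++ map (_, level) new × suc level ≤ suc r′
      neighbours nbs w e = let r′ , wr∈ = ∈-map-proj₁⁻ (nbs w e) in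
        r′ , subst ((w , r′) ∈ᴸ_) reassociate wr∈ , near (∈-++⁻ Q wr∈)

    ahead′ : ∀ {a b} → a ∈ᴸ ps ⊎ a ≡ (u , suc level) → b ∈ᴸ us ⊎ b ∈ᴸ map (_, level) new → proj₂ b ≤ proj₂ a
    ahead′ (inj₁ a∈)   (inj₁ b∈) = ahead ex a∈ (there b∈)
    ahead′ (inj₂ refl) (inj₁ b∈) = proj₁ (after b∈)
    ahead′ a∈          (inj₂ b∈) with ∈-map⁻ (_, level) b∈
    ahead′ (inj₁ a∈)   (inj₂ b∈) | _ , _ , refl = <⇒≤ (ahead ex a∈ (here refl))
    ahead′ (inj₂ refl) (inj₂ b∈) | _ , _ , refl = n≤1+n level

    sorted′ : AllPairs _ ((u , suc level) ∷ us) → AllPairs _ (us ++ map (_, level) new)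
    sorted′ (_ ∷ us-sorted) = AllPairsₚ.++⁺ us-sorted (constant-sorted level new)
      (All.tabulate λ a∈ → Allₚ.map⁺ (All.universal (λ _ → swap (after a∈)) new))

  module _ {Q} (ex : Explored Q []) where

    private
      Q≡ : Q ++ [] ≡ Q
      Q≡ = ++-identityʳ Q

    -- The number of steps left stays below the mark: a step lowers the former by one and, by
    -- `closed`, the latter by at most one. So no vertex on the walk before `v` was left unexpanded.
    explored-reach : ∀ {l u v r} → Walk G l u v → (u , r) ∈ᴸ Q → l < r → v ∈ᴸ map proj₁ Q
    explored-reach []      ur∈ _   = ∈-map⁺ proj₁ ur∈
    explored-reach (e ∷ p) ur∈ l<r with closed ex ur∈
    ... | inj₁ r≤1 = contradiction (≤-trans l<r r≤1) λ { (s≤s ()) }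
    ... | inj₂ nbs = let r′ , wr∈ , r≤ = nbs _ e in
      explored-reach p (subst (_ ∈ᴸ_) Q≡ wr∈) (≤-pred (≤-trans l<r r≤))

    -- A nonzero mark turns `l + r ≡ suc d` into `l < suc d`. Conversely, members of `X` carry the
    -- mark `suc d`, which suffices for every walk of length at most `d`.
    explored⇔ball : (∀ {v r} → (v , r) ∈ᴸ Q → r ≢ 0) → ∀ v → v ∈ᴸ map proj₁ Q ⇔ v ∈ ball G d X
    explored⇔ball nonzero v = mk⇔ to from
      where
      to : v ∈ᴸ map proj₁ Q → v ∈ ball G d X
      to v∈ with ∈-map-proj₁⁻ v∈
      ... | r , vr∈ with sound ex (subst (_ ∈ᴸ_) (sym Q≡) vr∈)
      ...   | x , l , x∈ , w , eq = ∈-ball⁺ G d X (x , x∈ , l , subst (l <_) eq (m<m+n l (n≢0⇒n>0 (nonzero vr∈))) , w)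

      from : v ∈ ball G d X → v ∈ᴸ map proj₁ Q
      from v∈ with ∈-ball⁻ G d X v∈
      ... | x , x∈ , l , l<1+d , w = explored-reach w (subst (_ ∈ᴸ_) Q≡ (roots ex x∈)) l<1+d

-- Correctness and amortised cost of one search

module Visiting (W : ℕ) {n : ℕ} (base : ℕ) (before : ℕ → ℕ) (base+n<W : base + n < W) (n*n<W : n * n < W)
  (G : Graph n) (d : ℕ) (X : Subset n) {s : State} (one : reg s rOne ≡ 1)
  (stored : StoresFamily s 0 1 (neighbourhood G)) where

  open Search W base before base+n<W
  open Queue
  open StoresFamily stored using (start-suc; members) renaming (list to adjacent; unique to adjacent-unique)

  adjacent⇒Adj : ∀ u {v} → v ∈ᴸ adjacent u → Adj G u v
  adjacent⇒Adj u v∈ = ∈-comprehension⁻ (adj? G u) (Equivalence.to (members u _) v∈)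

  Adj⇒adjacent : ∀ {u v} → Adj G u v → v ∈ᴸ adjacent u
  Adj⇒adjacent {u} e = Equivalence.from (members u _) (∈-comprehension⁺ (adj? G u) e)

  open Arcs G adjacent adjacent-unique adjacent⇒Adj

  start<W : ∀ k → k ≤ n → mem s 0 k < W
  start<W k k≤n = ≤-<-trans (≤-trans (start≤ stored k k≤n) (*-monoˡ-≤ n k≤n)) n*n<W

  record Visited (level : ℕ) (u : Fin n) (Q : List Entry) (tail : ℕ) (cells marks : ℕ → ℕ) : Set where
    field
      {new}   : List (Fin n)
      queue   : Queue tail cells marks (Q ++ at level new)
      new⊆    : ∀ {v} → v ∈ᴸ new → Adj G u v
      scanned : suc level ≤ 1 ⊎ (∀ w → Adj G u w → w ∈ᴸ vertices (Q ++ at level new))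

  visit-correct : ∀ {s′} → Agree visitAll s s′ → ∀ ps {us u level} →
    QueueAt s′ (ps ++ (u , suc level) ∷ us) → reg s′ rHead ≡ base + length ps →
    Reach W visit s′ (9 + length (adjacent u) * 9)
      (λ s″ → Visited level u (ps ++ (u , suc level) ∷ us) (reg s″ rTail) (mem s″ 8) (mem s″ 10))
  visit-correct {s′} agr ps {us} {u} {level} queue₀ head≡ =
    load-seq current (≤-<-trans (<⇒≤ (toℕ<n u)) n<W) (load-seq (proj₁ entry) (proj₂ (proj₂ entry))
    (arith-seq (cong (suc level ∸_) one′) (<-trans (n<1+n level) (proj₂ (proj₂ entry)))
    (ifnz-rule expand (λ level≡0 → weaken (s≤s z≤n) (λ _ post → post) (skip-rule (record
      { new     = []
      ; queue   = subst (Queue _ _ _) (sym (++-identityʳ _)) queue₀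
      ; new⊆    = λ ()
      ; scanned = inj₁ (s≤s (≤-reflexive level≡0))
      }))))))
    where
    Q : List Entry
    Q = ps ++ (u , suc level) ∷ us

    n<W : n < W
    n<W = ≤-<-trans (m≤n+m n base) base+n<W

    one′ : reg s′ rOne ≡ 1
    one′ = trans (regs agr rOne refl) one

    entry : mem s′ 10 (toℕ u) ≡ suc level × suc level ≢ 0 × suc level < W
    entry = mark queue₀ (∈-++⁺ʳ ps (here refl))

    current : mem s′ 8 (reg s′ rHead) ≡ toℕ u
    current = trans (cong (mem s′ 8) (trans head≡ (cong (base +_) (sym (length-map proj₁ ps)))))
      (Segment-at (vertices ps) (subst (Segment _ base) (map-++ proj₁ ps _) (segment queue₀)))

    starts : ∀ k → mem s′ 0 k ≡ mem s 0 k
    starts k = cong-app (arrs agr 0 refl) k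

    expand : level ≢ 0 → Reach W (load rPos 0 rCurrent ⨾ arith rEnd add rCurrent rOne ⨾ load rEnd 0 rEnd ⨾ scan 1)
      (setReg (setReg (setReg s′ rCurrent (toℕ u)) rLevel (suc level)) rLevel level) (5 + length (adjacent u) * 9)
      (λ s″ → Visited level u Q (reg s″ rTail) (mem s″ 8) (mem s″ 10))
    expand level≢0 = load-seq (starts (toℕ u)) (start<W _ (<⇒≤ (toℕ<n u)))
      (arith-seq (trans (cong (toℕ u +_) one′) (+-comm (toℕ u) 1)) (≤-<-trans (toℕ<n u) n<W)
      (load-seq (starts (suc (toℕ u))) (start<W _ (toℕ<n u))
      (weaken ≤-refl (λ _ → found) (scan-correct refl one′ (start-suc u) (start<W _ (toℕ<n u)) refl level≢0
        (<-trans (n<1+n level) (proj₂ (proj₂ entry)))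
        (subst (λ f → Segment f (mem s 0 (toℕ u)) (adjacent u)) (sym (arrs agr 1 refl)) (Segment-item stored u))
        queue₀))))
      where
      found : ∀ {tail cells marks} → Scanned (adjacent u) level Q tail cells marks → Visited level u Q tail cells marks
      found scan = record
        { queue   = Scanned.queue scan
        ; new⊆    = λ v∈ → adjacent⇒Adj u (Scanned.new⊆ scan v∈)
        ; scanned = inj₂ λ _ e → Scanned.complete scan (Adj⇒adjacent e)
        }

  -- The potential is the budget left after paying for the expanded prefix `ps`, plus 1 for the last
  -- test of the loop. It does not depend on the length of the queue, which still grows.
  record Progress (φ head tail : ℕ) (cells marks : ℕ → ℕ) : Set where
    field
      {ps us}  : List Entry
      head≡    : head ≡ base + length ps
      pays     : φ ≡ 1 + (budget ∸ cost (vertices ps))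
      queue    : Queue tail cells marks (ps ++ us)
      explored : Explored G d X ps us

  ProgressAt : ℕ → State → Set
  ProgressAt φ s = Progress φ (reg s rHead) (reg s rTail) (mem s 8) (mem s 10)

  visitAll-step : ∀ {φ s′} → Agree visitAll s s′ → ProgressAt φ s′ → reg s′ rHead < reg s′ rTail →
    ∃₂ λ φ′ δ → 3 + (δ + φ′) ≤ φ × Reach W visit s′ δ (λ s″ →
      reg s″ rHead + reg s″ rOne < W × reg s″ rTail < W × ProgressAt φ′ (advanced rOne rHead rTail rTodo₄ s″))
  visitAll-step agr record { ps = ps ; us = [] ; head≡ = head≡ ; queue = queue } head<tail = ⊥-elim (<-irrefl
    (trans head≡ (trans (cong (λ Q → base + length Q) (sym (++-identityʳ ps))) (sym (tail≡ queue)))) head<tail)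
  visitAll-step agr record { ps = ps ; us = (u , zero) ∷ us ; queue = queue } _ =
    contradiction refl (proj₁ (proj₂ (mark queue (∈-++⁺ʳ ps (here refl)))))
  visitAll-step {s′ = s′} agr record { ps = ps ; us = (u , suc level) ∷ us ; head≡ = head≡ ; pays = refl ; queue = queue ; explored = explored } head<tail =
    1 + (budget ∸ cost (vertices ps′)) , 9 + length (adjacent u) * 9 , ≤-reflexive pays ,
    weaken ≤-refl conclude (visit-correct agr ps queue head≡)
    where
    ps′ : List Entry
    ps′ = ps ∷ʳ (u , suc level)

    cost′ : cost (vertices ps′) ≡ cost (vertices ps) + (12 + length (adjacent u) * 9)
    cost′ = trans (cong cost (map-++ proj₁ ps _)) (trans (cost-++ (vertices ps) _) (cong (cost (vertices ps) +_) (cost-[ u ])))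

    -- Makes the truncated subtraction in the potential exact. The expanded prefix, with `u`
    -- included, is part of a queue without repetitions, and every such list is within budget.
    within : cost (vertices ps) + (12 + length (adjacent u) * 9) ≤ budget
    within = begin
      cost (vertices ps) + (12 + length (adjacent u) * 9) ≡⟨ cost′ ⟨
      cost (vertices ps′)                                 ≤⟨ m≤m+n _ (cost (vertices us)) ⟩
      cost (vertices ps′) + cost (vertices us)            ≡⟨ cost-++ (vertices ps′) (vertices us) ⟨
      cost (vertices ps′ ++ vertices us)                  ≡⟨ cong cost (map-++ proj₁ ps′ us) ⟨
      cost (vertices (ps′ ++ us))                         ≡⟨ cong (cost ∘ vertices) (++-assoc ps _ us) ⟩
      cost (vertices (ps ++ (u , suc level) ∷ us))        ≤⟨ cost≤budget (unique queue) ⟩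
      budget                                              ∎
      where open ≤-Reasoning

    pays : 3 + ((9 + length (adjacent u) * 9) + (1 + (budget ∸ cost (vertices ps′)))) ≡ 1 + (budget ∸ cost (vertices ps))
    pays = begin
      3 + ((9 + k) + (1 + (budget ∸ cost (vertices ps′))))  ≡⟨ rearrange k _ ⟩
      1 + ((12 + k) + (budget ∸ cost (vertices ps′)))       ≡⟨ cong (λ c → 1 + ((12 + k) + (budget ∸ c))) cost′ ⟩
      1 + ((12 + k) + (budget ∸ (c + (12 + k))))            ≡⟨ cong (λ x → 1 + ((12 + k) + x)) (∸-+-assoc budget c (12 + k)) ⟨
      1 + ((12 + k) + ((budget ∸ c) ∸ (12 + k)))            ≡⟨ cong (1 +_) (m+[n∸m]≡n (m+n≤o⇒m≤o∸n (12 + k) (≤-trans (≤-reflexive (+-comm (12 + k) c)) within))) ⟩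
      1 + (budget ∸ c)                                      ∎
      where
      open ≡-Reasoning
      k = length (adjacent u) * 9
      c = cost (vertices ps)
      rearrange : ∀ k x → 3 + ((9 + k) + (1 + x)) ≡ 1 + ((12 + k) + x)
      rearrange = solve-∀

    conclude : ∀ {s″} → Agree visit s′ s″ →
      Visited level u (ps ++ (u , suc level) ∷ us) (reg s″ rTail) (mem s″ 8) (mem s″ 10) →
      reg s″ rHead + reg s″ rOne < W × reg s″ rTail < W ×
      ProgressAt (1 + (budget ∸ cost (vertices ps′))) (advanced rOne rHead rTail rTodo₄ s″)
    conclude {s″} agr′ visited =
      subst (_< W) (sym head′) (≤-<-trans (subst (_< reg s′ rTail) head≡ head<tail) (tail<W queue)) ,
      tail<W (Visited.queue visited) ,
      record
        { head≡    = trans head′ (trans (sym (+-suc base _)) (cong (base +_) (sym (length-∷ʳ ps _))))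
        ; pays     = refl
        ; queue    = subst (Queue _ _ _) (trans (++-assoc ps _ _) (sym (++-assoc ps _ _))) (Visited.queue visited)
        ; explored = explored-step G d X explored (Visited.new⊆ visited) (Visited.scanned visited)
        }
      where
      head′ : reg s″ rHead + reg s″ rOne ≡ suc (base + length ps)
      head′ = trans (cong₂ _+_ (trans (regs agr′ rHead refl) head≡)
        (trans (regs agr′ rOne refl) (trans (regs agr rOne refl) one))) (+-comm _ 1)

  visitAll-correct : ∀ {Q} → reg s rHead ≡ base → QueueAt s Q → Explored G d X [] Q →
    Reach W visitAll s (2 + budget) (λ s′ → ∃ λ Q → QueueAt s′ Q × Explored G d X Q [])
  visitAll-correct head≡base queue₀ explored₀ = weaken ≤-refl (λ _ → finish)
    (upto-rule (λ ()) (λ ()) ProgressAt (λ p → ≤-trans (s≤s z≤n) (≤-reflexive (sym (Progress.pays p)))) (tail<W queue₀)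
      visitAll-step (record
        { head≡    = trans head≡base (sym (+-identityʳ base))
        ; pays     = refl
        ; queue    = queue₀
        ; explored = explored₀
        }))
    where
    finish : ∀ {head tail cells marks} → tail ≤ head × (∃ λ φ → Progress φ head tail cells marks) →
      ∃ λ Q → Queue tail cells marks Q × Explored G d X Q []
    finish (_ , _ , record { ps = ps ; us = [] ; queue = queue ; explored = explored }) =
      ps , subst (Queue _ _ _) (++-identityʳ ps) queue , explored
    finish {head} {tail} (tail≤head , _ , record { ps = ps ; us = a ∷ us ; head≡ = head≡ ; queue = queue }) =
      ⊥-elim (<⇒≱ (subst₂ _<_ (sym head≡) (sym (tail≡ queue)) (+-monoʳ-< base
        (subst (length ps <_) (sym (length-++ ps)) (m<m+n (length ps) z<s)))) tail≤head)

clear-correct : ∀ {W n s} → reg s rVertex ≡ 0 → reg s 0 ≡ n → reg s rOne ≡ 1 → reg s rZero ≡ 0 → n < W →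
  Reach W clear s (2 + n * 4) (λ s′ → ∀ {p} → p < n → mem s′ 10 p ≡ 0)
clear-correct {W} {n} {s} vertex≡0 size one zero≡0 n<W =
  count-rule (λ ()) refl refl refl (λ j s′ → ∀ {p} → p < j → mem s′ 10 p ≡ 0) 1 vertex≡0 size one z≤n n<W
    (λ {j} {s′} agr _ _ vertex≡ blank →
      store-rule vertex≡ (trans (regs agr rZero refl) zero≡0) (≤-<-trans z≤n n<W) (λ {p} → extend (mem s′ 10) j blank))
    (λ ())
  where
  extend : ∀ f j → (∀ {p} → p < j → f p ≡ 0) → ∀ {p} → p < suc j → update f j 0 p ≡ 0
  extend f j blank {p} p<1+j with m<1+n⇒m<n∨m≡n p<1+j
  ... | inj₁ p<j  = trans (update-other f 0 (λ eq → <⇒≢ p<j (sym eq))) (blank p<j)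
  ... | inj₂ refl = update-same f j 0

-- The table of new bags

module BagTables {n N : ℕ} (G : Graph n) (d : ℕ) (X : Fin N → Subset n) where

  -- `starts` and `items` are arrays 7 and 8. By `within` the list ends at or before the current
  -- tail, so later searches, which write from the tail on, leave it intact.
  record BagStored (i : Fin N) (limit : ℕ) (starts items : ℕ → ℕ) : Set where
    field
      list    : List (Fin n)
      unique  : Unique list
      members : ∀ v → v ∈ᴸ list ⇔ v ∈ ball G d (X i)
      end     : starts (suc (toℕ i)) ≡ starts (toℕ i) + length list
      segment : Segment items (starts (toℕ i)) list
      within  : starts (suc (toℕ i)) ≤ limit

  record BagsStored (j tail : ℕ) (starts items : ℕ → ℕ) : Set where
    field
      first : starts 0 ≡ 0
      tail≡ : tail ≡ starts j
      tail≤ : tail ≤ j * n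
      bag   : ∀ i → toℕ i < j → BagStored i tail starts items

  BagsStoredAt : ℕ → State → Set
  BagsStoredAt j s = BagsStored j (reg s rTail) (mem s 7) (mem s 8)

  -- The queue of the finished search serves as the new list as it stands. Earlier lists survive by
  -- `below` and `within`, and their start positions because only the entry after `t` is written.
  bagsStored-step : ∀ {W} {t : Fin N} {base starts items Q} {tail : ℕ} {items′ marks : ℕ → ℕ} base+n<W →
    BagsStored (toℕ t) base starts items → Search.Queue W base items base+n<W tail items′ marks Q → Explored G d (X t) Q [] →
    BagsStored (suc (toℕ t)) tail (update starts (suc (toℕ t)) tail) items′
  bagsStored-step {t = t} {base} {starts} {items} {Q} {tail} {items′} base+n<W stored queue explored = record
    { first = first
    ; tail≡ = sym (update-same starts (suc (toℕ t)) tail)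
    ; tail≤ = ≤-trans (≤-reflexive tail-eq) (≤-trans (+-mono-≤ tail≤ length≤n) (≤-reflexive (+-comm (toℕ t * n) n)))
    ; bag   = λ i i<1+t → stored′ i (m<1+n⇒m<n∨m≡n i<1+t)
    }
    where
    open BagsStored stored
    open Search.Queue queue using (length≤n; below; mark) renaming (tail≡ to tail-eq; unique to Q-unique; segment to Q-segment)

    starts′ : ℕ → ℕ
    starts′ = update starts (suc (toℕ t)) tail

    kept : ∀ {p} → p ≤ toℕ t → starts′ p ≡ starts p
    kept p≤t = update-other starts tail (λ eq → <⇒≢ (s≤s p≤t) (sym eq))

    base≤tail : base ≤ tail
    base≤tail = ≤-trans (m≤m+n base (length Q)) (≤-reflexive (sym tail-eq))

    stored′ : ∀ i → toℕ i < toℕ t ⊎ toℕ i ≡ toℕ t → BagStored i tail starts′ items′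
    stored′ i (inj₁ i<t) = record
      { list    = list
      ; unique  = unique
      ; members = members
      ; end     = trans (kept i<t) (trans end (cong (_+ length list) (sym (kept (<⇒≤ i<t)))))
      ; segment = subst (λ a → Segment items′ a list) (sym (kept (<⇒≤ i<t)))
          (Segment-cong below (≤-trans (≤-reflexive (sym end)) within) segment)
      ; within  = ≤-trans (≤-reflexive (kept i<t)) (≤-trans within base≤tail)
      }
      where open BagStored (bag i i<t)
    stored′ i (inj₂ i≡t) with toℕ-injective i≡t
    ... | refl = record
      { list    = map proj₁ Q
      ; unique  = Q-unique
      ; members = explored⇔ball G d (X i) explored (λ vr∈ → proj₁ (proj₂ (mark vr∈)))
      ; end     = trans (update-same starts (suc (toℕ i)) tail) (trans tail-eq
          (cong₂ _+_ (sym start≡base) (sym (length-map proj₁ Q))))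
      ; segment = subst (λ a → Segment items′ a (map proj₁ Q)) (sym start≡base) Q-segment
      ; within  = ≤-reflexive (update-same starts (suc (toℕ i)) tail)
      }
      where
      start≡base : starts′ (toℕ i) ≡ base
      start≡base = trans (kept ≤-refl) (sym tail≡)

  storesFamily : ∀ {s′} → BagsStoredAt N s′ → StoresFamily s′ 7 8 (ball G d ∘ X)
  storesFamily stored = record
    { list       = list ∘ stored-bag
    ; unique     = unique ∘ stored-bag
    ; members    = members ∘ stored-bag
    ; start-zero = BagsStored.first stored
    ; start-suc  = end ∘ stored-bag
    ; item       = Segment⇒lookup ∘ segment ∘ stored-bag
    }
    where
    open BagStored
    stored-bag : ∀ i → BagStored i _ _ _
    stored-bag i = BagsStored.bag stored i (toℕ<n i)

-- Searching from every bag

module Bags (W : ℕ) {n N : ℕ} (n*n<W : n * n < W) (N*n<W : N * n < W) (n<W : n < W) (N<W : N < W)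
  (G : Graph n) (d : ℕ) (d<W : suc d < W) (X : Fin N → Subset n) {s : State}
  (size : reg s 0 ≡ n) (nodes : reg s 1 ≡ N) (one : reg s rOne ≡ 1) (zero≡0 : reg s rZero ≡ 0) (top : reg s rTop ≡ suc d)
  (adjacency : StoresFamily s 0 1 (neighbourhood G)) (bags : StoresFamily s 4 5 X) where

  open BagTables G d X
  open StoresFamily bags using () renaming (list to bagList; start-suc to bag-start-suc; members to bag-members; unique to bag-unique)

  -- 25 is 4 for clearing a mark, 9 for scanning an entry of the old bag and 12 for visiting a
  -- vertex; 18 is 9 for each of the two arcs of an edge.
  bagTime : ℕ
  bagTime = 14 + n * 25 + ∣E G ∣ * 18

  searchBag-correct : ∀ {s′} → Agree searchAll s s′ → ∀ t → reg s′ rBag ≡ toℕ t → BagsStoredAt (toℕ t) s′ →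
    Reach W searchBag s′ bagTime (λ s″ → BagsStoredAt (suc (toℕ t)) (advanced rOne rBag 1 rTodo₂ s″))
  searchBag-correct {s′} agr t bag≡t stored = weaken time≤bagTime (λ _ post → post)
    (const-seq (≤-<-trans z≤n n<W)
    (clear-correct refl (trans (regs agr 0 refl) size) one′ zero′ n<W ▷ λ s₁ agr₁ blank →
    arith-seq (trans (cong₂ _+_ (regs agr₁ rTail refl) (trans (regs agr₁ rZero refl) zero′)) (+-identityʳ _))
      (≤-<-trans (m≤m+n _ n) base+n<W)
    (load-seq (cong₂ (λ f p → f p) (trans (arrs agr₁ 4 refl) (arrs agr 4 refl)) (trans (regs agr₁ rBag refl) bag≡t))
      (start<W (<⇒≤ (toℕ<n t)))
    (arith-seq (trans (cong₂ _+_ (trans (regs agr₁ rBag refl) bag≡t) (trans (regs agr₁ rOne refl) one′)) (+-comm (toℕ t) 1))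
      (≤-<-trans (toℕ<n t) N<W)
    (load-seq (cong-app (trans (arrs agr₁ 4 refl) (arrs agr 4 refl)) (suc (toℕ t))) (start<W (toℕ<n t))
    (arith-seq (trans (cong₂ _+_ (trans (regs agr₁ rTop refl) (trans (regs agr rTop refl) top)) (trans (regs agr₁ rZero refl) zero′))
      (+-identityʳ _)) d<W
    (scan-correct refl (trans (regs agr₁ rOne refl) one′) (bag-start-suc t) (start<W (toℕ<n t)) refl (λ ()) d<W
      (subst (λ f → Segment f (mem s 4 (toℕ t)) (bagList t)) (sym (trans (arrs agr₁ 5 refl) (arrs agr 5 refl))) (Segment-item bags t))
      (emptyQueue (regs agr₁ rTail refl) (λ p _ → cong-app (arrs agr₁ 8 refl) p) (λ v → blank (toℕ<n v))) ▷ λ s₂ agr₂ scanned →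
    Visiting.visitAll-correct W base before base+n<W n*n<W G d (X t)
      (trans (regs agr₂ rOne refl) (trans (regs agr₁ rOne refl) one′))
      (family-transport adjacency
        (trans (arrs agr₂ 0 refl) (trans (arrs agr₁ 0 refl) (arrs agr 0 refl)))
        (trans (arrs agr₂ 1 refl) (trans (arrs agr₁ 1 refl) (arrs agr 1 refl))))
      (regs agr₂ rHead refl) (Scanned.queue scanned) (explored₀ scanned) ▷ λ s₃ agr₃ (Q , queue , explored) →
    arith-seq (trans (cong₂ _+_
        (trans (regs agr₃ rBag refl) (trans (regs agr₂ rBag refl) (trans (regs agr₁ rBag refl) bag≡t)))
        (trans (regs agr₃ rOne refl) (trans (regs agr₂ rOne refl) (trans (regs agr₁ rOne refl) one′)))) (+-comm (toℕ t) 1))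
      (≤-<-trans (toℕ<n t) N<W)
    (store-rule refl refl (Search.Queue.tail<W queue) (subst
      (λ starts → BagsStored (suc (toℕ t)) (reg s₃ rTail) (update starts (suc (toℕ t)) (reg s₃ rTail)) (mem s₃ 8))
      (sym (trans (arrs agr₃ 7 refl) (trans (arrs agr₂ 7 refl) (arrs agr₁ 7 refl))))
      (bagsStored-step base+n<W stored queue explored))))))))))
    where
    base : ℕ
    base = reg s′ rTail

    before : ℕ → ℕ
    before = mem s′ 8

    base+n<W : base + n < W
    base+n<W = ≤-<-trans (≤-trans (+-monoˡ-≤ n (BagsStored.tail≤ stored))
      (≤-trans (≤-reflexive (+-comm (toℕ t * n) n)) (*-monoˡ-≤ n (toℕ<n t)))) N*n<W

    open Search W base before base+n<W using (emptyQueue; scan-correct; Scanned; vertices; at)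

    start<W : ∀ {k} → k ≤ N → mem s 4 k < W
    start<W k≤N = ≤-<-trans (≤-trans (start≤ bags _ k≤N) (*-monoˡ-≤ n k≤N)) N*n<W

    one′ : reg s′ rOne ≡ 1
    one′ = trans (regs agr rOne refl) one

    zero′ : reg s′ rZero ≡ 0
    zero′ = trans (regs agr rZero refl) zero≡0

    explored₀ : ∀ {tail cells marks} (scanned : Scanned (bagList t) (suc d) [] tail cells marks) →
      Explored G d (X t) [] (at (suc d) (Scanned.new scanned))
    explored₀ scanned = explored-start G d (X t)
      (λ v∈ → Equivalence.to (bag-members t _) (Scanned.new⊆ scanned v∈)) complete
      where
      complete : ∀ {v} → v ∈ X t → v ∈ᴸ Scanned.new scanned
      complete v∈ with ∈-map-proj₁⁻ (Scanned.complete scanned (Equivalence.from (bag-members t _) v∈))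
      ... | r , vr∈ with ∈-map⁻ (_, suc d) vr∈
      ...   | _ , v∈new , refl = v∈new

    time≤bagTime : 1 + (2 + n * 4 + (5 + (2 + length (bagList t) * 9 + (2 + (n * 12 + 2 * ∣E G ∣ * 9) + 2)))) ≤ bagTime
    time≤bagTime = ≤-trans
      (+-monoʳ-≤ (3 + n * 4) (+-monoʳ-≤ 7 (+-monoˡ-≤ _ (*-monoˡ-≤ 9 (Unique-length≤n (bag-unique t))))))
      (≤-reflexive (rearrange n ∣E G ∣))
      where
      rearrange : ∀ n e → 1 + (2 + n * 4 + (5 + (2 + n * 9 + (2 + (n * 12 + 2 * e * 9) + 2)))) ≡ 14 + n * 25 + e * 18
      rearrange = solve-∀

  searchAll-correct : reg s rBag ≡ 0 → BagsStoredAt 0 s → Reach W searchAll s (2 + N * (3 + bagTime)) (BagsStoredAt N)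
  searchAll-correct bag≡0 stored₀ = count-rule (λ ()) refl refl refl BagsStoredAt bagTime bag≡0 nodes one z≤n N<W
    (λ agr _ j<N bag≡j stored → body agr (fromℕ< j<N) (toℕ-fromℕ< j<N) bag≡j stored) stored₀
    where
    body : ∀ {j s′} → Agree searchAll s s′ → (t : Fin N) → toℕ t ≡ j → reg s′ rBag ≡ j → BagsStoredAt j s′ →
      Reach W searchBag s′ bagTime (λ s″ → BagsStoredAt (suc j) (advanced rOne rBag 1 rTodo₂ s″))
    body agr t refl bag≡t stored = searchBag-correct agr t bag≡t stored

-- Computing the new layering

assignLayers-correct : ∀ {W n m s} d (L : Fin n → Fin m) → m < W → n < W →
  reg s rVertex ≡ 0 → reg s 0 ≡ n → reg s rOne ≡ 1 → reg s rWidth ≡ 1 + 2 * d → (∀ v → mem s 6 (toℕ v) ≡ toℕ (L v)) →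
  Reach W assignLayers s (2 + n * 6) (λ s′ → ∀ v → mem s′ 9 (toℕ v) ≡ toℕ (L v) / (1 + 2 * d))
assignLayers-correct {W} {n} {m} {s} d L m<W n<W vertex≡0 size one width≡ layerOf =
  weaken ≤-refl (λ _ assigned v → assigned v (toℕ<n v))
    (count-rule (λ ()) refl refl refl I 3 vertex≡0 size one z≤n n<W
      (λ agr _ j<n vertex≡j assigned → body agr (fromℕ< j<n) (toℕ-fromℕ< j<n) vertex≡j assigned) (λ _ ()))
  where
  I : ℕ → State → Set
  I j s′ = ∀ v → toℕ v < j → mem s′ 9 (toℕ v) ≡ toℕ (L v) / (1 + 2 * d)

  body : ∀ {j s′} → Agree assignLayers s s′ → (v : Fin n) → toℕ v ≡ j → reg s′ rVertex ≡ j → I j s′ →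
    Reach W assignLayer s′ 3 (λ s″ → I (suc j) (advanced rOne rVertex 0 rTodo₁ s″))
  body {s′ = s′} agr v refl vertex≡v assigned =
    load-seq (trans (cong₂ (λ f p → f p) (arrs agr 6 refl) vertex≡v) (layerOf v)) layer<W
    (arith-seq (cong (⟦ quot ⟧ (toℕ (L v))) (trans (regs agr rWidth refl) width≡))
      (≤-<-trans (m/n≤m (toℕ (L v)) (1 + 2 * d)) layer<W)
    (store-rule vertex≡v refl (≤-<-trans (m/n≤m (toℕ (L v)) (1 + 2 * d)) layer<W)
      (λ w w<1+v → extend w (m<1+n⇒m<n∨m≡n w<1+v))))
    where
    layer<W : toℕ (L v) < W
    layer<W = <-trans (toℕ<n (L v)) m<W

    extend : ∀ w → toℕ w < toℕ v ⊎ toℕ w ≡ toℕ v →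
      update (mem s′ 9) (toℕ v) (toℕ (L v) / (1 + 2 * d)) (toℕ w) ≡ toℕ (L w) / (1 + 2 * d)
    extend w (inj₁ w<v) = trans (update-other (mem s′ 9) _ (λ eq → <⇒≢ w<v (sym eq))) (assigned w w<v)
    extend w (inj₂ w≡v) with toℕ-injective w≡v
    ... | refl = update-same (mem s′ 9) (toℕ v) _

-- Correctness of the whole program

module _ {W n N m : ℕ} (n*n<W : n * n < W) (N*n<W : N * n < W) (n<W : n < W) (N<W : N < W)
  (d : ℕ) (d<W : suc d < W) (width<W : 1 + 2 * d < W) (m+2d<W : m + 2 * d < W)
  (G : Graph n) (T : Graph N) (X : Fin N → Subset n) (L : Fin n → Fin m) where

  main-correct : ∀ {s} → Input s G T X L d →
    Reach W main s (15 + n * 6 + N * (17 + n * 25 + ∣E G ∣ * 18)) (λ s′ → Output s′ T (ball G d ∘ X) (coarsen L (2 * d)))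
  main-correct {s} input = weaken (≤-reflexive (rearrange n (N * (17 + n * 25 + ∣E G ∣ * 18)))) output
    (const-seq 1<W (const-seq 0<W
    (arith-seq (trans (cong (_+ 1) radius) (+-comm d 1)) d<W
    (arith-seq (trans (cong₂ _+_ radius radius) (cong (d +_) (sym (+-identityʳ d)))) (<-trans (n<1+n _) width<W)
    (arith-seq (cong (_+ 2 * d) (StoresLayering.numLayers layering)) m+2d<W
    (arith-seq (+-comm (2 * d) 1) width<W
    (arith-seq refl (≤-<-trans (m/n≤m (m + 2 * d) (1 + 2 * d)) m+2d<W)
    (const-seq 0<W
    (assignLayers-correct d L (≤-<-trans (m≤m+n m (2 * d)) m+2d<W) n<W refl (StoresGraph.vertices graph) refl refl
      (StoresLayering.layerOf layering) ▷ λ s₁ agr₁ assigned →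
    const-seq 0<W (const-seq 0<W (store-seq refl refl 0<W
    (weaken ≤-refl (λ agr₂ stored →
        BagTables.storesFamily G d X stored ,
        trans (regs agr₂ 4 refl) (regs agr₁ 4 refl) ,
        λ v → trans (cong-app (arrs agr₂ 9 refl) (toℕ v)) (assigned v))
    (Bags.searchAll-correct W n*n<W N*n<W n<W N<W G d d<W X
      (trans (regs agr₁ 0 refl) (StoresGraph.vertices graph))
      (trans (regs agr₁ 1 refl) (StoresGraph.vertices tree))
      (regs agr₁ rOne refl) (regs agr₁ rZero refl) (regs agr₁ rTop refl)
      (family-transport (StoresGraph.lists graph) (arrs agr₁ 0 refl) (arrs agr₁ 1 refl))
      (family-transport bags (arrs agr₁ 4 refl) (arrs agr₁ 5 refl))
      refl (record { first = refl ; tail≡ = refl ; tail≤ = z≤n ; bag = λ _ () }))))))))))))))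
    where
    open Input input

    0<W : 0 < W
    0<W = ≤-<-trans z≤n n<W

    1<W : 1 < W
    1<W = ≤-<-trans (s≤s z≤n) d<W

    rearrange : ∀ n x → 8 + (2 + n * 6 + (3 + (2 + x))) ≡ 15 + n * 6 + x
    rearrange = solve-∀

    output : ∀ {s′} → Agree main s s′ →
      StoresFamily s′ 7 8 (ball G d ∘ X) × reg s′ 4 ≡ ⌈ m / 1 + 2 * d ⌉ × (∀ v → mem s′ 9 (toℕ v) ≡ toℕ (L v) / (1 + 2 * d)) →
      Output s′ T (ball G d ∘ X) (coarsen L (2 * d))
    output agr (family , count , assigned) = record
      { tree     = record
        { vertices = trans (regs agr 1 refl) (StoresGraph.vertices tree)
        ; lists    = family-transport (StoresGraph.lists tree) (arrs agr 2 refl) (arrs agr 3 refl)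
        }
      ; bags     = family
      ; layering = record { numLayers = count ; layerOf = λ v → trans (assigned v) (sym (toℕ-coarsen L (2 * d) v)) }
      }

-- Word size

module WordBound {n N : ℕ} (G : Graph n) (T : Graph N) (m d : ℕ) where

  M : ℕ
  M = 2 + n + ∣E G ∣ + N + m + d

  ≤-by : ∀ {a b} c → a + c ≡ b → a ≤ b
  ≤-by {a} c eq = ≤-trans (m≤m+n a c) (≤-reflexive eq)

  M*M≡ : M * M ≡ wordBound 2 G T m d
  M*M≡ = cong (M *_) (sym (*-identityʳ M))

  -- The summand 2 in `M` makes this true for every input. Exponent 2 thus covers the products
  -- `n * n` and `N * n`, which bound positions, as well as m+2d, which may exceed `M` itself.
  2M≤M*M : M + M ≤ M * M
  2M≤M*M = ≤-trans (≤-reflexive (cong (M +_) (sym (+-identityʳ M)))) (*-monoˡ-≤ M {2} {M} (s≤s (s≤s z≤n)))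

  n<M : n < M
  n<M = ≤-by (1 + ∣E G ∣ + N + m + d) (eq n ∣E G ∣ N m d)
    where
    eq : ∀ n e N m d → suc n + (1 + e + N + m + d) ≡ 2 + n + e + N + m + d
    eq = solve-∀

  N<M : N < M
  N<M = ≤-by (1 + n + ∣E G ∣ + m + d) (eq n ∣E G ∣ N m d)
    where
    eq : ∀ n e N m d → suc N + (1 + n + e + m + d) ≡ 2 + n + e + N + m + d
    eq = solve-∀

  m+2d<2M : m + 2 * d < M + M
  m+2d<2M = ≤-by (3 + n + n + ∣E G ∣ + ∣E G ∣ + N + N + m) (eq n ∣E G ∣ N m d)
    where
    eq : ∀ n e N m d → suc (m + 2 * d) + (3 + n + n + e + e + N + N + m) ≡ (2 + n + e + N + m + d) + (2 + n + e + N + m + d)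
    eq = solve-∀

  1+2d<2M : 1 + 2 * d < M + M
  1+2d<2M = ≤-by (2 + n + n + ∣E G ∣ + ∣E G ∣ + N + N + m + m) (eq n ∣E G ∣ N m d)
    where
    eq : ∀ n e N m d → suc (1 + 2 * d) + (2 + n + n + e + e + N + N + m + m) ≡ (2 + n + e + N + m + d) + (2 + n + e + N + m + d)
    eq = solve-∀

  <M*M : ∀ {a} → a < M * M → a < wordBound 2 G T m d
  <M*M {a} = subst (a <_) M*M≡

  <2M : ∀ {a} → a < M + M → a < wordBound 2 G T m d
  <2M a<2M = <M*M (<-≤-trans a<2M 2M≤M*M)

  <M : ∀ {a} → a < M → a < wordBound 2 G T m d
  <M a<M = <2M (<-≤-trans a<M (m≤m+n M M))

-- 63 = 15 + 6 + 17 + 25: for positive `n` and `N` each of 1, `n` and `N` is at most `N * n`, and 18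
-- is below 63. Writing both as successors leaves a difference with nonnegative coefficients, given
-- explicitly.
main-time≤ : ∀ n N e → .{{_ : NonZero n}} → .{{_ : NonZero N}} →
  15 + n * 6 + N * (17 + n * 25 + e * 18) ≤ 63 * (N * (n + e))
main-time≤ (suc n) (suc N) e = ≤-trans (m≤m+n _ (n * 32 + e * 45 + N * 21 + N * n * 38 + N * e * 45)) (≤-reflexive (eq n N e))
  where
  eq : ∀ n N e → 15 + suc n * 6 + suc N * (17 + suc n * 25 + e * 18) + (n * 32 + e * 45 + N * 21 + N * n * 38 + N * e * 45) ≡ 63 * (suc N * (suc n + e))
  eq = solve-∀

theorem4p8 : (Σ Program λ P → Σ ℕ λ c → Σ ℕ λ b →
    ∀ {n N m : ℕ} (G : Graph n) (d k : ℕ) → 1 ≤ d → 1 ≤ k →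
    (T : Graph N) (X : Fin N → Subset n) (L : Fin n → Fin m) →
    IsTreeDecomposition G T X → IsLayering G L →
    (∀ t i → α (G [ X t ∩ layer L i ]) ≤ k) →
    (s : State) → Input s G T X L d →
    Σ State λ s′ → Σ ℕ λ time →
    Σ (Fin N → Subset n) λ X′ → Σ (Fin n → Fin ⌈ m / 1 + 2 * d ⌉) λ L′ →
    Run (wordBound b G T m d) P s time s′ ×
    (NonZero n → time ≤ c * (N * (n + ∣E G ∣))) ×
    Output s′ T X′ L′ ×
    IsTreeDecomposition (power G (1 + 2 * d)) T X′ ×
    IsLayering (power G (1 + 2 * d)) L′ ×
    (∀ t i → α (power G (1 + 2 * d) [ X′ t ∩ layer L′ i ]) ≤ (1 + 4 * d) * k))
    ×
    (∀ {n : ℕ} (G : Graph n) (d k : ℕ) → 1 ≤ d → 1 ≤ k →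
    IsLayeredTreeIndependenceNumber G k →
    LayeredTreeIndependenceNumberAtMost (power G (1 + 2 * d)) ((1 + 4 * d) * k))
theorem4p8 = (main , 63 , 2 , construct) , λ G d k _ _ → power-layeredTreeIndependenceNumber G d k
  where
  construct : ∀ {n N m : ℕ} (G : Graph n) (d k : ℕ) → 1 ≤ d → 1 ≤ k →
    (T : Graph N) (X : Fin N → Subset n) (L : Fin n → Fin m) →
    IsTreeDecomposition G T X → IsLayering G L →
    (∀ t i → α (G [ X t ∩ layer L i ]) ≤ k) →
    (s : State) → Input s G T X L d →
    Σ State λ s′ → Σ ℕ λ time →
    Σ (Fin N → Subset n) λ X′ → Σ (Fin n → Fin ⌈ m / 1 + 2 * d ⌉) λ L′ →
    Run (wordBound 2 G T m d) main s time s′ ×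
    (NonZero n → time ≤ 63 * (N * (n + ∣E G ∣))) ×
    Output s′ T X′ L′ ×
    IsTreeDecomposition (power G (1 + 2 * d)) T X′ ×
    IsLayering (power G (1 + 2 * d)) L′ ×
    (∀ t i → α (power G (1 + 2 * d) [ X′ t ∩ layer L′ i ]) ≤ (1 + 4 * d) * k)
  construct {n} {N} {m} G d k _ _ T X L decomposition layering small s input =
    final , time , ball G d ∘ X , coarsen L (2 * d) , run ,
    (λ nonZero → ≤-trans time≤ (main-time≤ n N ∣E G ∣ {{nonZero}} {{IsTree.nonempty (IsTreeDecomposition.isTree decomposition)}})) ,
    post ,
    ballDecomposition G d decomposition ,
    coarsen-layering G L layering d ,
    λ t → α-ball≤ G L layering d (X t) k (small t)
    where
    open WordBound G T m d
    open Reach (main-correct {wordBound 2 G T m d} (<M*M (*-mono-< n<M n<M)) (<M*M (*-mono-< N<M n<M)) (<M n<M) (<M N<M)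
      d (<M (s≤s (s≤s (m≤n+m d _)))) (<2M 1+2d<2M) (<2M m+2d<2M) G T X L input)
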